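{- For every $n\ge 4$, the $(1,3)$-biased Clique game on $K_n$ is won by player $2$.
   Context: Two players, Alice (player 1, starting) and Bob (player 2), alternately colour uncoloured edges of the complete graph $K_n$, Alice in red and Bob in blue. In the $(p,q)$-biased version Alice colours $p$ edges on each of her turns and Bob colours $q$ edges on each of his turns. In the Clique game, at the end Alice's score is $a=\omega(G[A])$ and Bob's score is $b=\omega(G[B])$, the clique numbers of the graphs formed by the red edges $A$ and the blue edges $B$. When $q>p$, Bob (player 2) wins if at the end $b>a$. Here $(p,q)=(1,3)$. -}

module Defs where

open import Data.Nat using (ℕ; zero; suc; _<_)
open import Data.Fin using (Fin) renaming (_<?_ to _<ᶠ?_)
open import Data.Fin.Subset using (Subset; ∣_∣) renaming (_∈_ to _∈ₛ_)
open import Data.List using (List; []; _∷_; allFin; cartesianProduct; filter)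
open import Data.List.Membership.Propositional using (_∈_)
open import Data.List.Relation.Unary.Any using (_─_)
open import Data.Product using (_×_; _,_; Σ; proj₁; proj₂)
open import Data.Sum using (_⊎_)
open import Relation.Binary.PropositionalEquality using (_≢_)
open import Relation.Unary using (Pred)

-- An edge of K_n is an ordered pair (i , j) with i < j.
Edge : ℕ → Set
Edge n = Fin n × Fin n

edgesK : (n : ℕ) → List (Edge n)
edgesK n = filter (λ e → proj₁ e <ᶠ? proj₂ e) (cartesianProduct (allFin n) (allFin n))

Adj : ∀ {n} → List (Edge n) → Fin n → Fin n → Set
Adj E i j = ((i , j) ∈ E) ⊎ ((j , i) ∈ E)

IsClique : ∀ {n} → List (Edge n) → Subset n → Set
IsClique {n} E S = (i j : Fin n) → i ∈ₛ S → j ∈ₛ S → i ≢ j → Adj E i j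

CliqueNumberGreater : ∀ {n} → (B A : List (Edge n)) → Set
CliqueNumberGreater {n} B A =
  Σ (Subset n) λ S → IsClique B S × ((T : Subset n) → IsClique A T → ∣ T ∣ < ∣ S ∣)

-- Whose turn it is, and how many edges that player still has to colour
-- in the current turn.
data Turn : Set where
  alice : ℕ → Turn
  bob   : ℕ → Turn

-- BobWins p q U R B t : in the (p,q)-biased Clique game, from the position
-- with uncoloured edges U, red (Alice) edges R, blue (Bob) edges B, and turn
-- state t, player 2 (Bob) has a strategy guaranteeing that at the end
-- ω(blue) > ω(red).  A player colours min(p or q, #uncoloured) edges per turn;
-- the game ends when no uncoloured edge remains.
data BobWins {n : ℕ} (p q : ℕ) : List (Edge n) → List (Edge n) → List (Edge n) → Turn → Set where
  done     : ∀ {R B t} → CliqueNumberGreater B R → BobWins p q [] R B t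
  aliceMove : ∀ {x xs R B k} →
    (∀ {e} (m : e ∈ (x ∷ xs)) → BobWins p q ((x ∷ xs) ─ m) (e ∷ R) B (alice k)) →
    BobWins p q (x ∷ xs) R B (alice (suc k))
  aliceEnd : ∀ {U R B} → BobWins p q U R B (bob q) → BobWins p q U R B (alice 0)
  bobMove  : ∀ {U R B k e} (m : e ∈ U) →
    BobWins p q (U ─ m) R (e ∷ B) (bob k) → BobWins p q U R B (bob (suc k))
  bobEnd   : ∀ {U R B} → BobWins p q U R B (alice p) → BobWins p q U R B (bob 0)

Player2Wins : (p q n : ℕ) → Set
Player2Wins p q n = BobWins {n} p q (edgesK n) [] [] (alice p)

{-# OPTIONS --safe #-}

-- Bob keeps a pairing σ of the vertices and a rank ρ on the pairs such that a red edge xy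
-- between two pairs with ρ y ≤ ρ x forces x σ(y) and σ(x) σ(y) to be blue. If T is a red clique
-- containing at most one vertex of each pair, then σ(T) is a blue clique of the same size, and
-- it remains to find one more vertex. A vertex x of T of maximal rank is blue to the rest of
-- σ(T), so it will do if its own edge x σ(x) is blue. Pairs whose own edge is red are put at
-- rank 0 and joined to a fixed vertex p in blue, so p serves if the maximal rank is 0 and
-- x σ(x) is red. For odd n, p is the unpaired vertex; when p lies in T, the extra vertex is v,
-- where v σ(v) is the first red edge: each red xp makes σ(x) blue to both p and v.
-- A red clique containing both x and σ(x) has size two, and Bob has a triangle.
-- The pairing of the vertices that meet no red edge, and are paired with such, may still be
-- changed; thus two such vertices joined by Alice can be made mates.
module Submission where

open import Defs
open import Data.Bool using (true)
open import Data.Empty using (⊥; ⊥-elim)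
open import Data.Fin using (Fin; zero; suc) renaming (_<_ to _<ᶠ_)
open import Data.Fin.Permutation.Components using (transpose)
open import Data.Fin.Properties using (_≟_; any?; all?; injective⇒≤; suc-injective) renaming (<-asym to <ᶠ-asym; <-cmp to <ᶠ-cmp; <⇒≢ to <ᶠ⇒≢)
open import Data.Fin.Subset using (Subset; ∣_∣; inside; outside; _-_) renaming (_∈_ to _∈ₛ_; ⊥ to ∅)
open import Data.Fin.Subset.Properties using (x∈p⇒∣p-x∣<∣p∣; x∈p∧x≢y⇒x∈p-y; anySubset?; ∣p∣≤n; ∉⊥) renaming (_∈?_ to _∈ₛ?_)
open import Data.List using (List; []; _∷_; length; allFin; cartesianProduct)
open import Data.List.Membership.Propositional using (_∈_)
open import Data.List.Membership.Propositional.Properties using (∈-filter⁺; ∈-cartesianProduct⁺; ∈-allFin)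
open import Data.List.Relation.Unary.All using (All; []; _∷_; lookup)
import Data.List.Relation.Unary.All as All
open import Data.List.Relation.Unary.AllPairs using ([]; _∷_)
open import Data.List.Relation.Unary.Any using (here; there; _─_)
open import Data.List.Relation.Unary.Unique.Propositional using (Unique)
import Data.List.Relation.Unary.Unique.Propositional.Properties as Uniqueₚ
import Data.List.Relation.Unary.All.Properties as Allₚ
open import Data.Nat using (ℕ; zero; suc; pred; _+_; _≤_; _<_; _≥_; z≤n; s≤s; _≤?_; _<?_)
open import Data.Nat.Properties using (≤-refl; ≤-trans; ≤-total; ≤-reflexive; <⇒≤; <-≤-trans; ≤-<-trans; <-irrefl; ≮⇒≥; n≤0⇒n≡0; m≤n⇒m≤1+n; <-cmp; n<1+n; +-suc; +-monoʳ-≤; m≤m+n) renaming (_≟_ to _≟ℕ_)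
open import Data.Product using (∃; _×_; _,_; proj₁; proj₂)
open import Data.Product.Properties using (≡-dec)
open import Data.Sum using (_⊎_; inj₁; inj₂; [_,_]′)
import Data.Sum as Sum
open import Data.Vec using (tabulate; []; _∷_; here; there)
open import Data.Vec.Properties using (lookup∘tabulate; lookup⇒[]=; []=⇒lookup)
open import Function using (_∘_; id; case_of_)
open import Relation.Binary.Definitions using (tri<; tri≈; tri>)
open import Relation.Binary.PropositionalEquality using (_≡_; _≢_; refl; sym; trans; cong; cong₂; subst; subst₂; ≢-sym)
open import Relation.Nullary using (¬_; Dec; yes; no; does; contradiction)
open import Relation.Nullary.Decidable using (_×-dec_; _⊎-dec_; ¬?; _→-dec_; dec-true)
open import Relation.Unary using (Decidable)

-- Legal positions and how a single move changes them.

private variable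
  n : ℕ
  U R B R′ B′ : List (Edge n)

Adj-sym : ∀ {E : List (Edge n)} {a b} → Adj E a b → Adj E b a
Adj-sym = Sum.swap

Adj? : (E : List (Edge n)) → ∀ a b → Dec (Adj E a b)
Adj? E a b = ((a , b) ∈? E) ⊎-dec ((b , a) ∈? E)
  where open import Data.List.Membership.DecPropositional (≡-dec _≟_ _≟_) using (_∈?_)

Same : (x y a b : Fin n) → Set
Same x y a b = (a ≡ x × b ≡ y) ⊎ (a ≡ y × b ≡ x)

record Proper (R B : List (Edge n)) : Set where
  field
    red-irrefl  : ∀ {a} → ¬ Adj R a a
    blue-irrefl : ∀ {a} → ¬ Adj B a a
    disjoint    : ∀ {a b} → Adj R a b → ¬ Adj B a b

record Valid (U R B : List (Edge n)) : Set where
  field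
    ordered : All (λ e → proj₁ e <ᶠ proj₂ e) U
    unique  : Unique U
    cover   : ∀ {a b} → a ≢ b → Adj U a b ⊎ Adj R a b ⊎ Adj B a b
    unred   : ∀ {a b} → Adj U a b → ¬ Adj R a b
    unblue  : ∀ {a b} → Adj U a b → ¬ Adj B a b
    proper  : Proper R B

-- The conditions are symmetric in the two colours, so only a red move has to be analysed; a blue
-- one is a red one with the colours exchanged.
Valid-swap : Valid U R B → Valid U B R
Valid-swap V = record
  { ordered = ordered ; unique = unique
  ; cover = λ a≢b → Sum.map₂ Sum.swap (cover a≢b)
  ; unred = unblue ; unblue = unred
  ; proper = record
    { red-irrefl = blue-irrefl ; blue-irrefl = red-irrefl
    ; disjoint = λ b r → disjoint r b } }
  where open Valid V
        open Proper proper

module _ {A : Set} where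

  ∈-─⁻ : ∀ {x y : A} {xs} (m : x ∈ xs) → y ∈ (xs ─ m) → y ∈ xs
  ∈-─⁻ (here _)  q         = there q
  ∈-─⁻ (there m) (here eq) = here eq
  ∈-─⁻ (there m) (there q) = there (∈-─⁻ m q)

  ∈-─⁺ : ∀ {x y : A} {xs} (m : x ∈ xs) → y ∈ xs → y ≡ x ⊎ y ∈ (xs ─ m)
  ∈-─⁺ (here refl) (here refl) = inj₁ refl
  ∈-─⁺ (here _)    (there q)   = inj₂ q
  ∈-─⁺ (there m)   (here eq)   = inj₂ (here eq)
  ∈-─⁺ (there m)   (there q)   = Sum.map₂ there (∈-─⁺ m q)

  Unique-─ : ∀ {x : A} {xs} (m : x ∈ xs) → Unique xs → Unique (xs ─ m)
  Unique-─ (here _)  (_ ∷ u) = u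
  Unique-─ (there m) (d ∷ u) = Allₚ.─⁺ m d ∷ Unique-─ m u

  ∉-─ : ∀ {x : A} {xs} (m : x ∈ xs) → Unique xs → ¬ x ∈ (xs ─ m)
  ∉-─ (here refl) (d ∷ u) q           = lookup d q refl
  ∉-─ (there m)   (d ∷ u) (here refl) = lookup d m refl
  ∉-─ (there m)   (d ∷ u) (there q)   = ∉-─ m u q

  length-─ : ∀ {x : A} {xs} (m : x ∈ xs) → length xs ≡ suc (length (xs ─ m))
  length-─ (here _)  = refl
  length-─ (there m) = cong suc (length-─ m)

Adj-∷ : ∀ {E : List (Edge n)} {i j a b} → Adj ((i , j) ∷ E) a b → Same i j a b ⊎ Adj E a b
Adj-∷ (inj₁ (here refl)) = inj₁ (inj₁ (refl , refl))
Adj-∷ (inj₁ (there q))   = inj₂ (inj₁ q)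
Adj-∷ (inj₂ (here refl)) = inj₁ (inj₂ (refl , refl))
Adj-∷ (inj₂ (there q))   = inj₂ (inj₂ q)

Adj-weaken : ∀ {E : List (Edge n)} {e a b} → Adj E a b → Adj (e ∷ E) a b
Adj-weaken = Sum.map there there

module _ {i j : Fin n} (V : Valid U R B) (m : (i , j) ∈ U) where
  open Valid V
  open Proper proper

  Adj-─⁻ : ∀ {a b} → Adj (U ─ m) a b → Adj U a b
  Adj-─⁻ = Sum.map (∈-─⁻ m) (∈-─⁻ m)

  Adj-─⁺ : ∀ {a b} → Adj U a b → Same i j a b ⊎ Adj (U ─ m) a b
  Adj-─⁺ (inj₁ q) with ∈-─⁺ m q
  ... | inj₁ refl = inj₁ (inj₁ (refl , refl))
  ... | inj₂ r    = inj₂ (inj₁ r)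
  Adj-─⁺ (inj₂ q) with ∈-─⁺ m q
  ... | inj₁ refl = inj₁ (inj₂ (refl , refl))
  ... | inj₂ r    = inj₂ (inj₂ r)

  ¬Adj-─ : ∀ {a b} → Same i j a b → ¬ Adj (U ─ m) a b
  ¬Adj-─ (inj₁ (refl , refl)) (inj₁ q) = ∉-─ m unique q
  ¬Adj-─ (inj₁ (refl , refl)) (inj₂ q) = <ᶠ-asym (lookup ordered m) (lookup ordered (∈-─⁻ m q))
  ¬Adj-─ (inj₂ (refl , refl)) (inj₁ q) = <ᶠ-asym (lookup ordered m) (lookup ordered (∈-─⁻ m q))
  ¬Adj-─ (inj₂ (refl , refl)) (inj₂ q) = ∉-─ m unique q

  playable-≢ : i ≢ j
  playable-≢ = <ᶠ⇒≢ (lookup ordered m)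

  Valid-red : Valid (U ─ m) ((i , j) ∷ R) B
  Valid-red = record
    { ordered = Allₚ.─⁺ m ordered
    ; unique  = Unique-─ m unique
    ; cover   = covered
    ; unred   = λ u r → [ (λ s → ¬Adj-─ s u) , unred (Adj-─⁻ u) ]′ (Adj-∷ r)
    ; unblue  = unblue ∘ Adj-─⁻
    ; proper  = record
      { red-irrefl = [ (λ { (inj₁ (refl , q)) → playable-≢ q ; (inj₂ (refl , q)) → playable-≢ (sym q) })
                     , red-irrefl ]′ ∘ Adj-∷
      ; blue-irrefl = blue-irrefl
      ; disjoint = [ (λ { (inj₁ (refl , refl)) → unblue (inj₁ m) ; (inj₂ (refl , refl)) → unblue (inj₂ m) })
                   , disjoint ]′ ∘ Adj-∷ } }
    where
      covered : ∀ {a b} → a ≢ b → Adj (U ─ m) a b ⊎ Adj ((i , j) ∷ R) a b ⊎ Adj B a b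
      covered a≢b with cover a≢b
      ... | inj₂ c = inj₂ (Sum.map₁ Adj-weaken c)
      ... | inj₁ u with Adj-─⁺ u
      ...   | inj₂ u′                   = inj₁ u′
      ...   | inj₁ (inj₁ (refl , refl)) = inj₂ (inj₁ (inj₁ (here refl)))
      ...   | inj₁ (inj₂ (refl , refl)) = inj₂ (inj₁ (inj₂ (here refl)))

Valid-blue : ∀ {i j : Fin n} → Valid U R B → (m : (i , j) ∈ U) → Valid (U ─ m) R ((i , j) ∷ B)
Valid-blue V m = Valid-swap (Valid-red (Valid-swap V) m)

Valid-start : ∀ n → Valid (edgesK n) [] []
Valid-start n = record
  { ordered = Allₚ.all-filter _ (cartesianProduct (allFin n) (allFin n))
  ; unique  = Uniqueₚ.filter⁺ _ (Uniqueₚ.cartesianProduct⁺ (Uniqueₚ.allFin⁺ n) (Uniqueₚ.allFin⁺ n))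
  ; cover   = covered
  ; unred   = λ { _ (inj₁ ()) ; _ (inj₂ ()) }
  ; unblue  = λ { _ (inj₁ ()) ; _ (inj₂ ()) }
  ; proper  = record
    { red-irrefl = λ { (inj₁ ()) ; (inj₂ ()) }
    ; blue-irrefl = λ { (inj₁ ()) ; (inj₂ ()) }
    ; disjoint = λ { (inj₁ ()) ; (inj₂ ()) } } }
  where
    edge : ∀ {a b} → a <ᶠ b → (a , b) ∈ edgesK n
    edge {a} {b} = ∈-filter⁺ _ (∈-cartesianProduct⁺ (∈-allFin a) (∈-allFin b))

    covered : ∀ {a b} → a ≢ b → Adj (edgesK n) a b ⊎ Adj [] a b ⊎ Adj [] a b
    covered {a} {b} a≢b with <ᶠ-cmp a b
    ... | tri< a<b _ _ = inj₁ (inj₁ (edge a<b))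
    ... | tri≈ _ a≡b _ = contradiction a≡b a≢b
    ... | tri> _ _ b<a = inj₁ (inj₂ (edge b<a))

-- From an invariant with bounded demands to a winning strategy.

Contains : List (Edge n) → List (Edge n) → Set
Contains E = All (λ e → Adj E (proj₁ e) (proj₂ e))

-- Only redness is excluded: a demanded edge may be blue already, in which case the demand costs no
-- move.
Demandable : List (Edge n) → List (Edge n) → Set
Demandable R = All (λ e → proj₁ e ≢ proj₂ e × ¬ Adj R (proj₁ e) (proj₂ e))

_⊑_ : List (Edge n) → List (Edge n) → Set
B ⊑ B′ = ∀ {a b} → Adj B a b → Adj B′ a b

Finishing : (List (Edge n) → List (Edge n) → Set) → Set
Finishing {n} I = ∀ {R B} → Proper R B → (∀ {a b} → a ≢ b → Adj R a b ⊎ Adj B a b) →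
                  I R B → CliqueNumberGreater B R

finish : {I : List (Edge n) → List (Edge n) → Set} → Finishing I →
         Valid [] R B → I R B → CliqueNumberGreater B R
finish fin V = fin proper λ a≢b → [ (λ { (inj₁ ()) ; (inj₂ ()) }) , id ]′ (cover a≢b)
  where open Valid V

-- A demanded edge that is no longer available is blue already, and surplus moves are spent
-- anywhere; this is sound because I is only required to follow from the demands being blue.
bobTurn : {I : List (Edge n) → List (Edge n) → Set} → Finishing I →
  ∀ k L {U R B} → Valid U R B → Demandable R L → length L ≤ k →
  (∀ {B′} → B ⊑ B′ → Contains B′ L → I R B′) →
  (∀ {U′ B′} → length U′ ≤ length U → Valid U′ R B′ → I R B′ → BobWins 1 3 U′ R B′ (alice 1)) →
  BobWins 1 3 U R B (bob k)
bobTurn fin zero [] V _ _ inv play = bobEnd (play ≤-refl V (inv id []))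
-- The board may run out in the middle of Bob's turn; all demands are met by then, so the final
-- position is judged at once.
bobTurn fin (suc k) [] {[]} V _ _ inv play = done (finish fin V (inv id []))
bobTurn fin (suc k) [] {e ∷ U} V _ _ inv play =
  bobMove (here refl) (bobTurn fin k [] (Valid-blue V (here refl)) [] z≤n
    (λ B⊑ _ → inv (B⊑ ∘ Adj-weaken) [])
    (λ le → play (m≤n⇒m≤1+n le)))
bobTurn fin (suc k) ((x , y) ∷ L) {U} {R} {B} V ((x≢y , ¬r) ∷ ds) (s≤s le) inv play with Valid.cover V x≢y
... | inj₂ (inj₁ r) = contradiction r ¬r
... | inj₂ (inj₂ b) = bobTurn fin (suc k) L V ds (m≤n⇒m≤1+n le) (λ B⊑ c → inv B⊑ (B⊑ b ∷ c)) play
... | inj₁ (inj₁ m) = bobMove m (bobTurn fin k L (Valid-blue V m) ds le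
    (λ B⊑ c → inv (B⊑ ∘ Adj-weaken) (B⊑ (inj₁ (here refl)) ∷ c))
    (λ le′ → play (≤-trans le′ (<⇒≤ (≤-reflexive (sym (length-─ m)))))))
... | inj₁ (inj₂ m) = bobMove m (bobTurn fin k L (Valid-blue V m) ds le
    (λ B⊑ c → inv (B⊑ ∘ Adj-weaken) (B⊑ (inj₂ (here refl)) ∷ c))
    (λ le′ → play (≤-trans le′ (<⇒≤ (≤-reflexive (sym (length-─ m)))))))

Responsive : (List (Edge n) → List (Edge n) → Set) → Set
Responsive {n} I = ∀ {R B x y} → Proper R B → x ≢ y → ¬ Adj R x y → ¬ Adj B x y → I R B →
  ∃ λ L → length L ≤ 3 × Demandable ((x , y) ∷ R) L ×
    (∀ {B′} → B ⊑ B′ → Contains B′ L → I ((x , y) ∷ R) B′)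

-- Induction on a bound for the number of uncoloured edges: Alice's move removes one and Bob's turn
-- adds none, which is why `bobTurn` passes on a length bound.
play : {I : List (Edge n) → List (Edge n) → Set} → Finishing I → Responsive I →
  ∀ k {U R B} → length U ≤ k → Valid U R B → I R B → BobWins 1 3 U R B (alice 1)
play fin resp k {[]} _ V inv = done (finish fin V inv)
play {I = I} fin resp (suc k) {u ∷ U} {R} {B} (s≤s le) V inv = aliceMove (λ m → aliceEnd (reply m))
  where
    open Valid V
    reply : ∀ {e} (m : e ∈ (u ∷ U)) → BobWins 1 3 ((u ∷ U) ─ m) (e ∷ R) B (bob 3)
    reply m with resp proper (playable-≢ V m) (unred (inj₁ m)) (unblue (inj₁ m)) inv
    ... | L , short , ds , inv′ = bobTurn fin 3 L (Valid-red V m) ds short inv′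
          (λ le′ → play fin resp k (≤-trans le′ (≤-trans (≤-reflexive (cong pred (sym (length-─ m)))) le)))

-- The invariant and Bob's answers to a red edge.

-- p is a fixed point of σ exactly when n is odd; the p-lone fields concern that case.
record Core (R B : List (Edge n)) (σ : Fin n → Fin n) (ρ : Fin n → ℕ) (v p : Fin n) : Set where
  field
    involutive : ∀ x → σ (σ x) ≡ x
    fixed      : ∀ {x} → σ x ≡ x → x ≡ p
    rank-σ     : ∀ x → ρ (σ x) ≡ ρ x
    v-rank     : ρ v ≡ 0
    v-red      : Adj R v (σ v)
    quad       : ∀ {x y} → Adj R x y → σ x ≢ x → σ y ≢ y → y ≢ σ x → ρ y ≤ ρ x →
                 Adj B x (σ y) × Adj B (σ x) (σ y)
    red-pair   : ∀ {x} → Adj R x (σ x) → ρ x ≡ 0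
    p-zero     : ∀ {x} → σ x ≢ x → ρ x ≡ 0 → Adj B p x
    p-paired   : σ p ≢ p → Adj B p (σ p) × ρ p ≡ 2
    p-lone     : σ p ≡ p → ∀ {x} → Adj R x p → Adj B (σ x) p × Adj B (σ x) v
    p-lone-v   : σ p ≡ p → ∀ {x} → Adj R x v → x ≢ σ v → Adj B p (σ x)

-- If x σ(x) is uncoloured, Alice may take it, and three replies must then bring the pair down to
-- rank 0: p x, p σ(x), and one edge at v. The conditions below say that these suffice.
Open : (R B : List (Edge n)) (σ : Fin n → Fin n) (ρ : Fin n → ℕ) (v p : Fin n) → Fin n → Set
Open R B σ ρ v p x =
  ρ x ≡ 1 ×
  (∀ {y} → Adj R x y → y ≢ σ x → y ≢ p × (y ≡ v ⊎ 1 < ρ y ⊎ Adj B (σ x) y)) ×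
  (Adj R x v → ¬ Adj R (σ x) v)

Status : (R B : List (Edge n)) (σ : Fin n → Fin n) (ρ : Fin n → ℕ) (v p : Fin n) → Fin n → Set
Status R B σ ρ v p x = Adj B x (σ x) ⊎ Adj R x (σ x) ⊎ Open R B σ ρ v p x

-- Pairing, ranks and the special vertices are existentially quantified here, because ranks and
-- mates may change from one round to the next.
record Inv (R B : List (Edge n)) : Set where
  constructor mkInv
  field
    σ      : Fin n → Fin n
    ρ      : Fin n → ℕ
    v p    : Fin n
    core   : Core R B σ ρ v p
    status : ∀ x → σ x ≢ x → Status R B σ ρ v p x

-- Records Alice's move through adjacency alone. This is insensitive to the orientation of the new
-- edge, so `Answer-sym` can halve the case distinctions.
record Recolour (R R′ : List (Edge n)) (x y : Fin n) : Set where
  field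
    split : ∀ {a b} → Adj R′ a b → Same x y a b ⊎ Adj R a b
    keep  : ∀ {a b} → Adj R a b → Adj R′ a b
    add   : Adj R′ x y

Free : (R : List (Edge n)) (x y : Fin n) → Edge n → Set
Free R x y (a , b) = a ≢ b × ¬ Same x y a b × ¬ Adj R a b

Answer : (R B : List (Edge n)) (x y : Fin n) → Set
Answer R B x y = ∃ λ L → length L ≤ 3 × All (Free R x y) L ×
  (∀ {R′ B′} → Recolour R R′ x y → B ⊑ B′ → Contains B′ L → Inv R′ B′)

Same-swap : ∀ {x y a b : Fin n} → Same x y a b → Same y x a b
Same-swap = Sum.swap

Answer-sym : ∀ {x y} → Answer R B x y → Answer R B y x
Answer-sym (L , short , free , inv) =
  L , short , All.map (λ { (d , s , r) → d , s ∘ Same-swap , r }) free ,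
  λ rec → inv record
    { split = Sum.map₁ Same-swap ∘ Recolour.split rec
    ; keep = Recolour.keep rec
    ; add = Adj-sym (Recolour.add rec) }

-- Old red neighbours keep their justification because blue only grows and the ranks stay; what
-- remains is the new red edge at `z` and the condition at `v`.
Open-mono : ∀ {σ ρ} {v p x y z : Fin n} → Recolour R R′ x y → B ⊑ B′ → Open R B σ ρ v p z →
  (∀ {t} → Same x y z t → t ≢ p × (t ≡ v ⊎ 1 < ρ t ⊎ Adj B′ (σ z) t)) →
  (Adj R′ z v → ¬ Adj R′ (σ z) v) → Open R′ B′ σ ρ v p z
Open-mono rec B⊑ (r , reds , _) new vs =
  r , (λ a d → [ new , (λ a′ → let h = reds a′ d in proj₁ h , Sum.map₂ (Sum.map₂ B⊑) (proj₂ h)) ]′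
                (Recolour.split rec a)) , vs

-- Replies that keep the pairing and the ranks.

module Position {R B : List (Edge n)} {σ ρ v p} (proper : Proper R B) (core : Core R B σ ρ v p) where
  open Proper proper
  open Core core public

  σ-injective : ∀ {a b} → σ a ≡ σ b → a ≡ b
  σ-injective {a} {b} eq = trans (sym (involutive a)) (trans (cong σ eq) (involutive b))

  Paired : Fin n → Set
  Paired x = σ x ≢ x

  paired-σ : ∀ {x} → Paired x → Paired (σ x)
  paired-σ d eq = d (σ-injective eq)

  Adj-≢ : ∀ {a b} → Adj R a b → a ≢ b
  Adj-≢ r refl = red-irrefl r

  Blue-≢ : ∀ {a b} → Adj B a b → a ≢ b
  Blue-≢ r refl = blue-irrefl r

  v-paired : Paired v
  v-paired eq = red-irrefl (subst (Adj R v) eq v-red)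

  pv-blue : Adj B p v
  pv-blue = p-zero v-paired v-rank

  p≢v : p ≢ v
  p≢v = Blue-≢ pv-blue

  -- The second conclusion of `quad` is symmetric, so it can be read off from whichever endpoint has
  -- the larger rank.
  mirror : ∀ {a b} → Adj R a b → Paired a → Paired b → b ≢ σ a → Adj B (σ a) (σ b)
  mirror {a} {b} r da db b≢ with ≤-total (ρ b) (ρ a)
  ... | inj₁ le = proj₂ (quad r da db b≢ le)
  ... | inj₂ le = Adj-sym (proj₂ (quad (Adj-sym r) db da (λ e → b≢ (trans (sym (involutive b)) (cong σ (sym e)))) le))

  -- Guarantees that a reply is still possible: were the edge between the mates red, `mirror` would
  -- have made `a b` blue long ago.
  mirror⁻ : ∀ {a b} → Paired a → Paired b → b ≢ σ a → ¬ Adj B a b → ¬ Adj R (σ a) (σ b)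
  mirror⁻ {a} {b} da db b≢ ¬b r =
    ¬b (subst₂ (Adj B) (involutive a) (involutive b)
      (mirror r (paired-σ da) (paired-σ db) (λ e → b≢ (σ-injective e))))

  -- The same for the other reply: a red edge from `a` to `σ b` would have forced `a b` to be blue
  -- through `quad`.
  quad⁻ : ∀ {a b} → Paired a → Paired b → a ≢ b → ρ b ≤ ρ a → ¬ Adj B a b → ¬ Adj R a (σ b)
  quad⁻ {a} {b} da db a≢b le ¬b r =
    ¬b (subst (Adj B a) (involutive b)
      (proj₁ (quad r da (paired-σ db) (λ e → a≢b (sym (σ-injective e))) (subst (_≤ ρ a) (sym (rank-σ b)) le))))

  module Reply {x y : Fin n} (x-paired : Paired x) (y-paired : Paired y) (x≢y : x ≢ y) (y≢σx : y ≢ σ x)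
               (¬blue : ¬ Adj B x y) where

    x≢σy : x ≢ σ y
    x≢σy eq = y≢σx (trans (sym (involutive y)) (cong σ (sym eq)))

    σx≢σy : σ x ≢ σ y
    σx≢σy = x≢y ∘ σ-injective

    -- An edge between two different pairs lies neither inside a pair nor at an unpaired `p`, so
    -- only `quad` for the new edge and `p-lone-v` have to be checked again.
    extend : Recolour R R′ x y → B ⊑ B′ →
      (∀ {a b} → Same x y a b → ρ b ≤ ρ a → Adj B′ a (σ b) × Adj B′ (σ a) (σ b)) →
      (σ p ≡ p → ∀ {a} → Same x y a v → Adj B′ p (σ a)) →
      Core R′ B′ σ ρ v p
    extend {R′} {B′} rec B⊑ quad′ lone-v′ = record
      { involutive = involutive ; fixed = fixed ; rank-σ = rank-σ ; v-rank = v-rank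
      ; v-red = keep v-red
      ; quad = λ r da db d le → [ (λ s → quad′ s le)
                                , (λ r′ → let h = quad r′ da db d le in B⊑ (proj₁ h) , B⊑ (proj₂ h)) ]′ (split r)
      ; red-pair = λ r → [ (λ { (inj₁ (refl , q)) → contradiction (sym q) y≢σx
                              ; (inj₂ (refl , q)) → contradiction (sym q) x≢σy }) , red-pair ]′ (split r)
      ; p-zero = λ d z → B⊑ (p-zero d z)
      ; p-paired = λ d → let h = p-paired d in B⊑ (proj₁ h) , proj₂ h
      ; p-lone = λ e r → [ (λ { (inj₁ (_ , q)) → contradiction (subst (λ t → σ t ≡ t) q e) y-paired
                              ; (inj₂ (_ , q)) → contradiction (subst (λ t → σ t ≡ t) q e) x-paired })
                         , (λ r′ → let h = p-lone e r′ in B⊑ (proj₁ h) , B⊑ (proj₂ h)) ]′ (split r)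
      ; p-lone-v = λ e r d → [ lone-v′ e , (λ r′ → B⊑ (p-lone-v e r′ d)) ]′ (split r)
      }
      where open Recolour rec

    -- Strict inequality of the ranks leaves one orientation to serve, so two blue edges satisfy
    -- `quad` and the third reply is free for another purpose.
    oriented : ρ y < ρ x → Adj B′ x (σ y) → Adj B′ (σ x) (σ y) →
               ∀ {a b} → Same x y a b → ρ b ≤ ρ a → Adj B′ a (σ b) × Adj B′ (σ a) (σ b)
    oriented _  d₁ d₂ (inj₁ (refl , refl)) _  = d₁ , d₂
    oriented lt d₁ d₂ (inj₂ (refl , refl)) le = contradiction (<-≤-trans lt le) (<-irrefl refl)

    xσy-free : ρ y ≤ ρ x → Free R x y (x , σ y)
    xσy-free le = x≢σy , (λ { (inj₁ (_ , q)) → y-paired q ; (inj₂ (q , _)) → x≢y q }) ,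
                  quad⁻ x-paired y-paired x≢y le ¬blue

    σxσy-free : Free R x y (σ x , σ y)
    σxσy-free = σx≢σy , (λ { (inj₁ (q , _)) → x-paired q ; (inj₂ (q , _)) → y≢σx (sym q) }) ,
                mirror⁻ x-paired y-paired y≢σx ¬blue

    xσx-free : ¬ Adj R x (σ x) → Free R x y (x , σ x)
    xσx-free ¬r = ≢-sym x-paired , (λ { (inj₁ (_ , q)) → y≢σx (sym q) ; (inj₂ (q , _)) → x≢y q }) , ¬r

    yσy-free : ¬ Adj R y (σ y) → Free R x y (y , σ y)
    yσy-free ¬r = ≢-sym y-paired , (λ { (inj₁ (q , _)) → x≢y (sym q) ; (inj₂ (_ , q)) → x≢σy (sym q) }) , ¬r

    new-red-at : ∀ {z t} → Same x y z t → z ≡ x ⊎ z ≡ y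
    new-red-at = Sum.map proj₁ proj₁


  data At (x z : Fin n) : Set where
    at-x : z ≡ x → At x z
    at-σ : z ≡ σ x → At x z
    off  : z ≢ x → z ≢ σ x → At x z

  at : ∀ x z → At x z
  at x z with z ≟ x | z ≟ σ x
  ... | yes e | _     = at-x e
  ... | no _  | yes e = at-σ e
  ... | no d  | no d′ = off d d′

  pair-blue : ∀ {x B′} → Adj B′ x (σ x) → Adj B′ (σ x) (σ (σ x))
  pair-blue {x} {B′} b = Adj-sym (subst (λ t → Adj B′ t (σ x)) (sym (involutive x)) b)

  σ-flip : ∀ {a b} → σ a ≡ b → a ≡ σ b
  σ-flip {a} eq = trans (sym (involutive a)) (cong σ eq)

  module _ {x y : Fin n} (x-paired : Paired x) (y-paired : Paired y) (x≢y : x ≢ y) (y≢σx : y ≢ σ x)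
           (¬blue : ¬ Adj B x y) where
    open Reply x-paired y-paired x≢y y≢σx ¬blue

    -- Two replies satisfy `quad`, and the third closes the pair of `x` in blue. `status` is asked
    -- only outside that pair, because its rank may just have been raised, and `Open` insists on
    -- rank 1.
    outrank : ρ y < ρ x → y ≢ v →
              (∀ z → Paired z → z ≢ x → z ≢ σ x → Status R B σ ρ v p z) → Answer R B x y
    outrank lt y≢v status with x ≟ p
    ... | no x≢p =
      (x , σ y) ∷ (σ x , σ y) ∷ (x , σ x) ∷ [] , ≤-refl ,
      xσy-free (<⇒≤ lt) ∷ σxσy-free ∷ xσx-free xσx-unred ∷ [] ,
      λ { rec B⊑ (d₁ ∷ d₂ ∷ d₃ ∷ []) →
          mkInv σ ρ v p (extend rec B⊑ (oriented lt d₁ d₂) no-v) (status′ rec B⊑ d₃) }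
      where
        xσx-unred : ¬ Adj R x (σ x)
        xσx-unred r = contradiction (subst (ρ y <_) (red-pair r) lt) λ ()

        v≢x : v ≢ x
        v≢x refl = contradiction (subst (ρ y <_) v-rank lt) λ ()

        no-v : ∀ {B′} → σ p ≡ p → ∀ {a} → Same x y a v → Adj B′ p (σ a)
        no-v _ (inj₁ (_ , q)) = contradiction (sym q) y≢v
        no-v _ (inj₂ (_ , q)) = contradiction q v≢x

        status′ : ∀ {R′ B′} → Recolour R R′ x y → B ⊑ B′ → Adj B′ x (σ x) →
                  ∀ z → Paired z → Status R′ B′ σ ρ v p z
        status′ rec B⊑ d₃ z z-paired with at x z
        ... | at-x refl = inj₁ d₃
        ... | at-σ refl = inj₁ (pair-blue d₃)
        ... | off z≢x z≢σx with status z z-paired z≢x z≢σx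
        ...   | inj₁ b        = inj₁ (B⊑ b)
        ...   | inj₂ (inj₁ r) = inj₂ (inj₁ (Recolour.keep rec r))
        -- If `z` is `y`, openness says that `y` has rank 1; its new red neighbour `x` then has rank
        -- above 1, which `Open` accepts.
        ...   | inj₂ (inj₂ o) = inj₂ (inj₂ (Open-mono {σ = σ} rec B⊑ o
                  (λ { (inj₁ (q , _)) → contradiction q z≢x
                     ; (inj₂ (refl , refl)) → x≢p , inj₂ (inj₁ (subst (_< ρ x) (proj₁ o) lt)) })
                  λ r r′ → [ (λ { (inj₁ (q , _)) → z≢x q ; (inj₂ (_ , q)) → v≢x q })
                           , (λ s → [ (λ { (inj₁ (q , _)) → z≢σx (σ-flip q) ; (inj₂ (_ , q)) → v≢x q })
                                    , proj₂ (proj₂ o) s ]′ (Recolour.split rec r′)) ]′ (Recolour.split rec r)))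
    -- Here `x` is `p`, whose own edge is blue already. But `Open` forbids a red neighbour `p`, so
    -- the third reply settles the pair of `y` instead, unless that pair is red.
    ... | yes refl = answer (Adj? R y (σ y))
      where
        no-v : ∀ {B′} → σ p ≡ p → ∀ {a} → Same x y a v → Adj B′ p (σ a)
        no-v e = contradiction e x-paired

        status′ : ∀ {R′ B′} → Recolour R R′ x y → B ⊑ B′ → Adj B′ y (σ y) ⊎ Adj R y (σ y) →
                  ∀ z → Paired z → Status R′ B′ σ ρ v p z
        status′ {R′} {B′} rec B⊑ yσy z z-paired with at x z
        ... | at-x refl = inj₁ (B⊑ (proj₁ (p-paired x-paired)))
        ... | at-σ refl = inj₁ (B⊑ (pair-blue (proj₁ (p-paired x-paired))))
        ... | off z≢x z≢σx with at y z
        ...   | at-x refl = [ inj₁ , inj₂ ∘ inj₁ ∘ Recolour.keep rec ]′ yσy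
        ...   | at-σ refl = [ inj₁ ∘ pair-blue , inj₂ ∘ inj₁ ∘ Recolour.keep rec ∘ pair-blue ]′ yσy
        ...   | off z≢y z≢σy with status z z-paired z≢x z≢σx
        ...     | inj₁ b        = inj₁ (B⊑ b)
        ...     | inj₂ (inj₁ r) = inj₂ (inj₁ (Recolour.keep rec r))
        ...     | inj₂ (inj₂ o) = inj₂ (inj₂ (Open-mono {σ = σ} rec B⊑ o
                    (λ s → ⊥-elim ([ z≢x , z≢y ]′ (new-red-at s)))
                    λ r r′ → [ (λ s → [ z≢x , z≢y ]′ (new-red-at s))
                             , (λ s → [ (λ s′ → [ z≢σx ∘ σ-flip , z≢σy ∘ σ-flip ]′ (new-red-at s′))
                                      , proj₂ (proj₂ o) s ]′ (Recolour.split rec r′)) ]′ (Recolour.split rec r)))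

        answer : Dec (Adj R y (σ y)) → Answer R B x y
        answer (yes r) =
          (x , σ y) ∷ (σ x , σ y) ∷ [] , s≤s (s≤s z≤n) ,
          xσy-free (<⇒≤ lt) ∷ σxσy-free ∷ [] ,
          λ { rec B⊑ (d₁ ∷ d₂ ∷ []) →
              mkInv σ ρ v p (extend rec B⊑ (oriented lt d₁ d₂) no-v) (status′ rec B⊑ (inj₂ r)) }
        answer (no ¬r) =
          (x , σ y) ∷ (σ x , σ y) ∷ (y , σ y) ∷ [] , ≤-refl ,
          xσy-free (<⇒≤ lt) ∷ σxσy-free ∷ yσy-free ¬r ∷ [] ,
          λ { rec B⊑ (d₁ ∷ d₂ ∷ d₃ ∷ []) →
              mkInv σ ρ v p (extend rec B⊑ (oriented lt d₁ d₂) no-v) (status′ rec B⊑ (inj₁ d₃)) }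

    -- With equal ranks `quad` applies in both orientations, and its three distinct requirements use
    -- up the replies. Open pairs stay open, since the mate of each endpoint becomes blue to the
    -- other endpoint.
    level : ρ x ≡ ρ y → (∀ z → Paired z → Status R B σ ρ v p z) → Answer R B x y
    level same status =
      (x , σ y) ∷ (σ x , σ y) ∷ (σ x , y) ∷ [] , ≤-refl ,
      xσy-free (≤-reflexive (sym same)) ∷ σxσy-free ∷ σxy-free ∷ [] ,
      λ { rec B⊑ (d₁ ∷ d₂ ∷ d₃ ∷ []) →
          mkInv σ ρ v p (extend rec B⊑ (full d₁ d₂ d₃) (lone-v′ B⊑)) (status′ rec B⊑ d₁ d₃) }
      where
        σxy-free : Free R x y (σ x , y)
        σxy-free = ≢-sym y≢σx , (λ { (inj₁ (q , _)) → x-paired q ; (inj₂ (q , _)) → y≢σx (sym q) }) ,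
                   quad⁻ y-paired x-paired (≢-sym x≢y) (≤-reflexive same) (¬blue ∘ Adj-sym) ∘ Adj-sym

        full : ∀ {B′} → Adj B′ x (σ y) → Adj B′ (σ x) (σ y) → Adj B′ (σ x) y →
               ∀ {a b} → Same x y a b → ρ b ≤ ρ a → Adj B′ a (σ b) × Adj B′ (σ a) (σ b)
        full d₁ d₂ d₃ (inj₁ (refl , refl)) _ = d₁ , d₂
        full d₁ d₂ d₃ (inj₂ (refl , refl)) _ = Adj-sym d₃ , Adj-sym d₂

        -- If one endpoint is `v`, both have rank 0, and `p-zero` has already joined the mates to
        -- `p`.
        lone-v′ : ∀ {B′} → B ⊑ B′ → σ p ≡ p → ∀ {a} → Same x y a v → Adj B′ p (σ a)
        lone-v′ B⊑ _ (inj₁ (refl , refl)) = B⊑ (p-zero (paired-σ x-paired) (trans (rank-σ x) (trans same v-rank)))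
        lone-v′ B⊑ _ (inj₂ (refl , refl)) = B⊑ (p-zero (paired-σ y-paired) (trans (rank-σ y) (trans (sym same) v-rank)))

        not-v : ∀ {w} → ρ w ≡ 1 → ¬ Same x y w v
        not-v r (inj₁ (refl , refl)) = contradiction (trans (sym r) (trans same v-rank)) λ ()
        not-v r (inj₂ (refl , refl)) = contradiction (trans (sym r) (trans (sym same) v-rank)) λ ()

        not-p : ∀ {t} → Paired t → ρ t ≡ 1 → t ≢ p
        not-p d r refl = contradiction (trans (sym r) (proj₂ (p-paired d))) λ ()

        status′ : ∀ {R′ B′} → Recolour R R′ x y → B ⊑ B′ → Adj B′ x (σ y) → Adj B′ (σ x) y →
                  ∀ z → Paired z → Status R′ B′ σ ρ v p z
        status′ rec B⊑ d₁ d₃ z z-paired with status z z-paired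
        ... | inj₁ b        = inj₁ (B⊑ b)
        ... | inj₂ (inj₁ r) = inj₂ (inj₁ (Recolour.keep rec r))
        ... | inj₂ (inj₂ o) = inj₂ (inj₂ (Open-mono {σ = σ} rec B⊑ o
                (λ { (inj₁ (refl , refl)) → not-p y-paired (trans (sym same) (proj₁ o)) , inj₂ (inj₂ d₃)
                   ; (inj₂ (refl , refl)) → not-p x-paired (trans same (proj₁ o)) , inj₂ (inj₂ (Adj-sym d₁)) })
                λ r r′ → [ not-v (proj₁ o)
                         , (λ s → [ not-v (trans (rank-σ z) (proj₁ o))
                                  , proj₂ (proj₂ o) s ]′ (Recolour.split rec r′)) ]′ (Recolour.split rec r)))

  -- For odd n, p σ(x) is a third reply next to x σ(v) and σ(x) σ(v), so x σ(x) has to wait;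
  -- if σ(x) v is red already, those two edges are blue and x σ(x) can be taken.
  attach : ∀ {x} → Paired x → x ≢ v → v ≢ σ x → ¬ Adj B x v → 0 < ρ x →
           (∀ z → Paired z → Status R B σ ρ v p z) → Answer R B x v
  attach {x} x-paired x≢v v≢σx ¬blue pos status = answer (Adj? R (σ x) v) lone-demand
    where
      open Reply x-paired v-paired x≢v v≢σx ¬blue

      lt : ρ v < ρ x
      lt = subst (_< ρ x) (sym v-rank) pos

      le : ρ v ≤ ρ x
      le = <⇒≤ lt

      lone-demand : ∃ λ L → length L ≤ 1 × All (Free R x v) L ×
                    (∀ {B′} → Contains B′ L → σ p ≡ p → Adj B′ p (σ x))
      lone-demand with σ p ≟ p
      ... | no p-paired′ = [] , z≤n , [] , λ _ e → contradiction e p-paired′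
      ... | yes e = (p , σ x) ∷ [] , ≤-refl ,
        ((λ q → not-p (σ-flip (sym q))) ,
         (λ { (inj₁ (q , _)) → not-p (trans (sym q) (sym e)) ; (inj₂ (q , _)) → p≢v q }) ,
         (λ r → ¬blue (subst (λ t → Adj B t v) (involutive x) (proj₂ (p-lone e (Adj-sym r)))))) ∷ [] ,
        λ { (d ∷ []) _ → d }
        where
          not-p : x ≢ σ p
          not-p q = x-paired (trans (cong σ (trans q e)) (sym q))

      lone-v′ : ∀ {B′} → (σ p ≡ p → Adj B′ p (σ x)) → σ p ≡ p → ∀ {a} → Same x v a v → Adj B′ p (σ a)
      lone-v′ d e (inj₁ (refl , _)) = d e
      lone-v′ d e (inj₂ (_ , q))    = contradiction (sym q) x≢v

      carry : ∀ {R′ B′} → Recolour R R′ x v → B ⊑ B′ → ∀ z → Paired z →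
              (Open R B σ ρ v p z → Adj R′ z v → ¬ Adj R′ (σ z) v) → Status R′ B′ σ ρ v p z
      carry rec B⊑ z z-paired vs with status z z-paired
      ... | inj₁ b        = inj₁ (B⊑ b)
      ... | inj₂ (inj₁ r) = inj₂ (inj₁ (Recolour.keep rec r))
      ... | inj₂ (inj₂ o) = inj₂ (inj₂ (Open-mono {σ = σ} rec B⊑ o
              (λ { (inj₁ (_ , refl)) → ≢-sym p≢v , inj₁ refl
                 ; (inj₂ (refl , _)) → contradiction (trans (sym (proj₁ o)) v-rank) λ () })
              (vs o)))

      unaffected : ∀ {R′} → Recolour R R′ x v → ∀ {z} → z ≢ x → z ≢ σ x →
                   Open R B σ ρ v p z → Adj R′ z v → ¬ Adj R′ (σ z) v
      unaffected rec z≢x z≢σx o r r′ =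
        [ (λ { (inj₁ (q , _)) → z≢x q ; (inj₂ (_ , q)) → x≢v (sym q) })
        , (λ s → [ (λ { (inj₁ (q , _)) → z≢σx (σ-flip q) ; (inj₂ (_ , q)) → x≢v (sym q) })
                 , proj₂ (proj₂ o) s ]′ (Recolour.split rec r′)) ]′ (Recolour.split rec r)

      answer : Dec (Adj R (σ x) v) →
               (∃ λ L → length L ≤ 1 × All (Free R x v) L ×
                 (∀ {B′} → Contains B′ L → σ p ≡ p → Adj B′ p (σ x))) → Answer R B x v
      -- Both `x` and `σ x` would now be red to `v`, which `Open` rules out, so the pair has to be
      -- closed in this round.
      answer (yes r) (L , short , free , lone) =
        (x , σ x) ∷ L , s≤s (≤-trans short (s≤s z≤n)) ,
        xσx-free (λ r′ → contradiction (subst (0 <_) (red-pair r′) pos) λ ()) ∷ free ,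
        λ { rec B⊑ (d ∷ ds) → mkInv σ ρ v p
              (extend rec B⊑ (oriented lt (B⊑ (subst (λ t → Adj B t (σ v)) (involutive x) (proj₂ old)))
                                       (B⊑ (proj₁ old))) (lone-v′ (lone ds)))
              (status′ rec B⊑ d) }
        where
          old : Adj B (σ x) (σ v) × Adj B (σ (σ x)) (σ v)
          old = quad r (paired-σ x-paired) v-paired (λ q → x≢v (sym (trans q (involutive x))))
                  (subst (ρ v ≤_) (sym (rank-σ x)) le)

          status′ : ∀ {R′ B′} → Recolour R R′ x v → B ⊑ B′ → Adj B′ x (σ x) →
                    ∀ z → Paired z → Status R′ B′ σ ρ v p z
          status′ rec B⊑ d z z-paired with at x z
          ... | at-x refl    = inj₁ d
          ... | at-σ refl    = inj₁ (pair-blue d)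
          ... | off z≢x z≢σx = carry rec B⊑ z z-paired (unaffected rec z≢x z≢σx)
      answer (no ¬r) (L , short , free , lone) =
        (x , σ v) ∷ (σ x , σ v) ∷ L , s≤s (s≤s short) ,
        xσy-free le ∷ σxσy-free ∷ free ,
        λ { rec B⊑ (d₁ ∷ d₂ ∷ ds) → mkInv σ ρ v p
              (extend rec B⊑ (oriented lt d₁ d₂) (lone-v′ (lone ds))) (status′ rec B⊑) }
        where
          -- Only one vertex of the pair becomes red to `v`, so the last condition of `Open`
          -- survives.
          ¬σxv : ∀ {R′} → Recolour R R′ x v → ¬ Adj R′ (σ x) v
          ¬σxv rec r = [ (λ { (inj₁ (q , _)) → x-paired q ; (inj₂ (q , _)) → v≢σx (sym q) }) , ¬r ]′ (Recolour.split rec r)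

          status′ : ∀ {R′ B′} → Recolour R R′ x v → B ⊑ B′ → ∀ z → Paired z → Status R′ B′ σ ρ v p z
          status′ rec B⊑ z z-paired = carry rec B⊑ z z-paired (vs (at x z))
            where
              vs : At x z → Open R B σ ρ v p z → Adj _ z v → ¬ Adj _ (σ z) v
              vs (at-x refl)      _ _ r = ¬σxv rec r
              vs (at-σ refl)      _ r _ = ¬σxv rec r
              vs (off z≢x z≢σx) o r r′  = unaffected rec z≢x z≢σx o r r′

  -- Two replies restore `p-lone`; the third closes the pair, as `Open` forbids the red neighbour
  -- `p`. None of the three can be red: by `p-lone`, `p-lone-v` or `p-zero` the edge `x p` would
  -- then be blue.
  lone : σ p ≡ p → ∀ {x} → Paired x → ¬ Adj B x p →
         (∀ z → Paired z → Status R B σ ρ v p z) → Answer R B x p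
  lone e {x} x-paired ¬blue status =
    (σ x , p) ∷ (σ x , v) ∷ (x , σ x) ∷ [] , ≤-refl ,
    (σx≢p , (λ { (inj₁ (q , _)) → x-paired q ; (inj₂ (q , _)) → σx≢p q }) ,
      λ r → ¬blue (subst (λ t → Adj B t p) (involutive x) (proj₁ (p-lone e r)))) ∷
    (σx≢v , (λ { (inj₁ (q , _)) → x-paired q ; (inj₂ (q , _)) → σx≢p q }) ,
      λ r → ¬blue (Adj-sym (subst (Adj B p) (involutive x) (p-lone-v e r (x≢v ∘ σ-injective))))) ∷
    (≢-sym x-paired , (λ { (inj₁ (_ , q)) → σx≢p q ; (inj₂ (q , _)) → x≢p q }) ,
      λ r → ¬blue (Adj-sym (p-zero x-paired (red-pair r)))) ∷ [] ,
    λ { rec B⊑ (d₁ ∷ d₂ ∷ d₃ ∷ []) → mkInv σ ρ v p (core′ rec B⊑ d₁ d₂) (status′ rec B⊑ d₃) }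
    where
      x≢p : x ≢ p
      x≢p refl = x-paired e

      σx≢p : σ x ≢ p
      σx≢p q = x≢p (trans (σ-flip q) e)

      x≢v : x ≢ v
      x≢v refl = ¬blue (Adj-sym pv-blue)

      σx≢v : σ x ≢ v
      σx≢v q = ¬blue (Adj-sym (p-zero x-paired (trans (sym (rank-σ x)) (trans (cong ρ q) v-rank))))

      core′ : ∀ {R′ B′} → Recolour R R′ x p → B ⊑ B′ → Adj B′ (σ x) p → Adj B′ (σ x) v → Core R′ B′ σ ρ v p
      core′ rec B⊑ d₁ d₂ = record
        { involutive = involutive ; fixed = fixed ; rank-σ = rank-σ ; v-rank = v-rank
        ; v-red = keep v-red
        ; quad = λ r da db d le → [ (λ { (inj₁ (_ , refl)) → contradiction e db ; (inj₂ (refl , _)) → contradiction e da })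
                                  , (λ r′ → let h = quad r′ da db d le in B⊑ (proj₁ h) , B⊑ (proj₂ h)) ]′ (split r)
        ; red-pair = λ r → [ (λ { (inj₁ (refl , q)) → contradiction q σx≢p
                                ; (inj₂ (refl , q)) → contradiction (trans (sym q) e) x≢p }) , red-pair ]′ (split r)
        ; p-zero = λ d z → B⊑ (p-zero d z)
        ; p-paired = λ d → contradiction e d
        ; p-lone = λ _ r → [ (λ { (inj₁ (refl , _)) → d₁ , d₂ ; (inj₂ (_ , q)) → contradiction (sym q) x≢p })
                           , (λ r′ → let h = p-lone e r′ in B⊑ (proj₁ h) , B⊑ (proj₂ h)) ]′ (split r)
        ; p-lone-v = λ _ r d → [ (λ { (inj₁ (_ , q)) → contradiction (sym q) p≢v
                                    ; (inj₂ (_ , q)) → contradiction (sym q) x≢v })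
                               , (λ r′ → B⊑ (p-lone-v e r′ d)) ]′ (split r)
        }
        where open Recolour rec

      status′ : ∀ {R′ B′} → Recolour R R′ x p → B ⊑ B′ → Adj B′ x (σ x) →
                ∀ z → Paired z → Status R′ B′ σ ρ v p z
      status′ rec B⊑ d z z-paired with at x z
      ... | at-x refl = inj₁ d
      ... | at-σ refl = inj₁ (pair-blue d)
      ... | off z≢x z≢σx with status z z-paired
      ...   | inj₁ b        = inj₁ (B⊑ b)
      ...   | inj₂ (inj₁ r) = inj₂ (inj₁ (Recolour.keep rec r))
      ...   | inj₂ (inj₂ o) = inj₂ (inj₂ (Open-mono {σ = σ} rec B⊑ o
                (λ { (inj₁ (q , _)) → contradiction q z≢x ; (inj₂ (refl , _)) → contradiction e z-paired })
                λ r r′ → [ (λ { (inj₁ (q , _)) → z≢x q ; (inj₂ (refl , _)) → z-paired e })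
                         , (λ s → [ (λ { (inj₁ (q , _)) → z≢σx (σ-flip q)
                                       ; (inj₂ (q , _)) → z-paired (trans q (sym (trans (σ-flip q) e))) })
                                  , proj₂ (proj₂ o) s ]′ (Recolour.split rec r′)) ]′ (Recolour.split rec r)))

-- Lowering a pair to rank 0, and resetting pairs without red edges.

module _ {P : Fin n → Set} (P? : Decidable P) (r : ℕ) (ρ : Fin n → ℕ) where

  assign : Fin n → ℕ
  assign z with P? z
  ... | yes _ = r
  ... | no  _ = ρ z

  assign-in : ∀ {z} → P z → assign z ≡ r
  assign-in {z} Pz with P? z
  ... | yes _  = refl
  ... | no ¬Pz = contradiction Pz ¬Pz

  assign-out : ∀ {z} → ¬ P z → assign z ≡ ρ z
  assign-out {z} ¬Pz with P? z
  ... | yes Pz = contradiction Pz ¬Pz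
  ... | no  _  = refl

InPair : (σ : Fin n → Fin n) → Fin n → Fin n → Set
InPair σ x z = z ≡ x ⊎ z ≡ σ x

inPair? : (σ : Fin n → Fin n) (x : Fin n) → Decidable (InPair σ x)
inPair? σ x z = (z ≟ x) ⊎-dec (z ≟ σ x)

module _ {R B : List (Edge n)} {σ ρ v p} (proper : Proper R B) (core : Core R B σ ρ v p) where
  open Position proper core

  inPair-σ : ∀ {x z} → InPair σ x z → InPair σ x (σ z)
  inPair-σ (inj₁ refl) = inj₂ refl
  inPair-σ (inj₂ refl) = inj₁ (involutive _)

  inPair-σ⁻ : ∀ {x z} → InPair σ x (σ z) → InPair σ x z
  inPair-σ⁻ {x} {z} h = subst (InPair σ x) (involutive z) (inPair-σ h)

  inPair-≡ : ∀ {x a b} → InPair σ x a → InPair σ x b → b ≡ a ⊎ b ≡ σ a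
  inPair-≡ (inj₁ refl) h           = h
  inPair-≡ (inj₂ refl) (inj₁ refl) = inj₂ (sym (involutive _))
  inPair-≡ (inj₂ refl) (inj₂ refl) = inj₁ refl

  same-inPair : ∀ {x a b} → Same x (σ x) a b → InPair σ x a × InPair σ x b
  same-inPair (inj₁ (q , q′)) = inj₁ q , inj₂ q′
  same-inPair (inj₂ (q , q′)) = inj₂ q , inj₁ q′

  -- Lowering the pair to rank 0 reverses the direction of `quad` on its red edges to rank 0
  -- vertices. `Open` ensures that the blue edges needed there exist already, except at `v`.
  redden : ∀ {x} → Paired x → ¬ Adj R x (σ x) → ¬ Adj B x (σ x) →
           (∀ z → Paired z → Status R B σ ρ v p z) → Answer R B x (σ x)
  redden {x} x-paired ¬red ¬blue status = answer v-demand
    where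
      x-open : Open R B σ ρ v p x
      x-open with status x x-paired
      ... | inj₁ b        = contradiction b ¬blue
      ... | inj₂ (inj₁ r) = contradiction r ¬red
      ... | inj₂ (inj₂ o) = o

      σx-open : Open R B σ ρ v p (σ x)
      σx-open with status (σ x) (paired-σ x-paired)
      ... | inj₁ b        = contradiction (Adj-sym (subst (Adj B (σ x)) (involutive x) b)) ¬blue
      ... | inj₂ (inj₁ r) = contradiction (Adj-sym (subst (Adj R (σ x)) (involutive x) r)) ¬red
      ... | inj₂ (inj₂ o) = o

      open-in : ∀ {z} → InPair σ x z → Open R B σ ρ v p z
      open-in (inj₁ refl) = x-open
      open-in (inj₂ refl) = σx-open

      paired-in : ∀ {z} → InPair σ x z → Paired z
      paired-in (inj₁ refl) = x-paired
      paired-in (inj₂ refl) = paired-σ x-paired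

      p-out : ¬ InPair σ x p
      p-out (inj₁ refl) = ¬blue (proj₁ (p-paired x-paired))
      p-out (inj₂ refl) = ¬blue (Adj-sym (subst (Adj B (σ x)) (involutive x) (proj₁ (p-paired (paired-σ x-paired)))))

      v-out : ¬ InPair σ x v
      v-out (inj₁ refl) = ¬red v-red
      v-out (inj₂ refl) = ¬red (Adj-sym (subst (Adj R (σ x)) (involutive x) v-red))

      p-free : ∀ {z} → InPair σ x z → Free R x (σ x) (p , z)
      p-free {z} h = (λ { refl → p-out h }) , p-out ∘ proj₁ ∘ same-inPair ,
        λ r → proj₁ (proj₁ (proj₂ (open-in h)) (Adj-sym r) (λ q → p-out (subst (InPair σ x) (sym q) (inPair-σ h)))) refl

      v-free : ∀ {z} → InPair σ x z → ¬ Adj R z v → Free R x (σ x) (z , v)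
      v-free h ¬r = (λ { refl → v-out h }) , v-out ∘ proj₂ ∘ same-inPair , ¬r

      -- By the last condition of `Open` at most one of `x` and `σ x` is red to `v`, so a single
      -- demand at `v` suffices.
      v-demand : ∃ λ L → length L ≤ 1 × All (Free R x (σ x)) L ×
                 (∀ {B′} → Contains B′ L → ∀ {z} → InPair σ x z → Adj R z v → Adj B′ (σ z) v)
      v-demand with Adj? R x v | Adj? R (σ x) v
      ... | yes r | _ = (σ x , v) ∷ [] , ≤-refl , v-free (inj₂ refl) (proj₂ (proj₂ x-open) r) ∷ [] ,
        λ { (d ∷ []) (inj₁ refl) _ → d
          ; (d ∷ []) (inj₂ refl) r′ → contradiction r′ (proj₂ (proj₂ x-open) r) }
      ... | no ¬r | yes r = (x , v) ∷ [] , ≤-refl , v-free (inj₁ refl) ¬r ∷ [] ,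
        λ { (d ∷ []) (inj₁ refl) r′ → contradiction r′ ¬r
          ; {B′} (d ∷ []) (inj₂ refl) _ → subst (λ t → Adj B′ t v) (sym (involutive x)) d }
      ... | no ¬r | no ¬r′ = [] , z≤n , [] ,
        λ { [] (inj₁ refl) r → contradiction r ¬r
          ; [] (inj₂ refl) r → contradiction r ¬r′ }

      ρ′ : Fin n → ℕ
      ρ′ = assign (inPair? σ x) 0 ρ

      ρ′-in : ∀ {z} → InPair σ x z → ρ′ z ≡ 0
      ρ′-in = assign-in (inPair? σ x) 0 ρ

      ρ′-out : ∀ {z} → ¬ InPair σ x z → ρ′ z ≡ ρ z
      ρ′-out = assign-out (inPair? σ x) 0 ρ

      ρ′-zero : ∀ {z} → ρ z ≡ 0 → ρ′ z ≡ 0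
      ρ′-zero {z} h with inPair? σ x z
      ... | yes _ = refl
      ... | no  _ = h

      rank-σ′ : ∀ z → ρ′ (σ z) ≡ ρ′ z
      rank-σ′ z with inPair? σ x z
      ... | yes h = ρ′-in (inPair-σ h)
      ... | no ¬h = trans (ρ′-out (¬h ∘ inPair-σ⁻)) (rank-σ z)

      quad′ : ∀ {B′} → B ⊑ B′ → (∀ {z} → InPair σ x z → Adj R z v → Adj B′ (σ z) v) →
              ∀ {a b} → Adj R a b → Paired a → Paired b → b ≢ σ a → ρ′ b ≤ ρ′ a →
              Adj B′ a (σ b) × Adj B′ (σ a) (σ b)
      quad′ {B′} B⊑ vd {a} {b} r da db d le with inPair? σ x a | inPair? σ x b
      ... | no _  | no _  = let h = quad r da db d le in B⊑ (proj₁ h) , B⊑ (proj₂ h)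
      ... | yes h | yes h′ = contradiction (inPair-≡ h h′) [ ≢-sym (Adj-≢ r) , d ]′
      ... | yes h | no _  = let k = quad r da db d (≤-trans le z≤n) in B⊑ (proj₁ k) , B⊑ (proj₂ k)
      ... | no _  | yes h with ρ b ≤? ρ a
      ...   | yes le′ = let k = quad r da db d le′ in B⊑ (proj₁ k) , B⊑ (proj₂ k)
      -- Here `a` has rank 0, so of the three alternatives in `Open` only `v` and the blue edge to
      -- `σ b` remain.
      ...   | no ¬le = Adj-sym σba , B⊑ (mirror r da db d)
        where
          low : ¬ 1 < ρ a
          low lt = ¬le (≤-trans (≤-reflexive (proj₁ (open-in h))) (<⇒≤ lt))

          σba : Adj B′ (σ b) a
          σba with proj₂ (proj₁ (proj₂ (open-in h)) (Adj-sym r) (λ q → d (trans (sym (involutive b)) (cong σ (sym q)))))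
          ... | inj₁ refl      = vd h (Adj-sym r)
          ... | inj₂ (inj₁ lt) = contradiction lt low
          ... | inj₂ (inj₂ k)  = B⊑ k

      core′ : ∀ {R′ B′} → Recolour R R′ x (σ x) → B ⊑ B′ →
              (∀ {z} → InPair σ x z → Adj B′ p z) →
              (∀ {z} → InPair σ x z → Adj R z v → Adj B′ (σ z) v) → Core R′ B′ σ ρ′ v p
      core′ {R′} {B′} rec B⊑ pd vd = record
        { involutive = involutive ; fixed = fixed ; rank-σ = rank-σ′ ; v-rank = ρ′-zero v-rank
        ; v-red = keep v-red
        ; quad = λ r da db d le → [ (λ s → contradiction (let h , h′ = same-inPair s in inPair-≡ h h′)
                                             [ same-≢ s , d ]′)
                                  , (λ r′ → quad′ B⊑ vd r′ da db d le) ]′ (split r)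
        ; red-pair = λ r → [ ρ′-in ∘ proj₁ ∘ same-inPair , ρ′-zero ∘ red-pair ]′ (split r)
        ; p-zero = p-zero′
        ; p-paired = λ d → let h = p-paired d in B⊑ (proj₁ h) , trans (ρ′-out p-out) (proj₂ h)
        ; p-lone = λ e r → [ (λ s → contradiction (proj₂ (same-inPair s)) p-out)
                           , (λ r′ → let h = p-lone e r′ in B⊑ (proj₁ h) , B⊑ (proj₂ h)) ]′ (split r)
        ; p-lone-v = λ e r d → [ (λ s → contradiction (proj₂ (same-inPair s)) v-out)
                               , (λ r′ → B⊑ (p-lone-v e r′ d)) ]′ (split r)
        }
        where
          open Recolour rec
          same-≢ : ∀ {a b} → Same x (σ x) a b → b ≢ a
          same-≢ (inj₁ (refl , q)) q′ = x-paired (trans (sym q) q′)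
          same-≢ (inj₂ (q , refl)) q′ = x-paired (trans (sym q) (sym q′))

          p-zero′ : ∀ {z} → Paired z → ρ′ z ≡ 0 → Adj B′ p z
          p-zero′ {z} d h with inPair? σ x z
          ... | yes k = pd k
          ... | no _  = B⊑ (p-zero d h)

      status′ : ∀ {R′ B′} → Recolour R R′ x (σ x) → B ⊑ B′ → ∀ z → Paired z → Status R′ B′ σ ρ′ v p z
      status′ {R′} rec B⊑ z z-paired with at x z
      ... | at-x refl = inj₂ (inj₁ (Recolour.add rec))
      ... | at-σ refl = inj₂ (inj₁ (pair-blue (Recolour.add rec)))
      ... | off z≢x z≢σx with status z z-paired
      ...   | inj₁ b = inj₁ (B⊑ b)
      ...   | inj₂ (inj₁ r) = inj₂ (inj₁ (Recolour.keep rec r))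
      -- The alternative `1 < ρ y` survives the change of ranks, because the lowered pair had rank
      -- 1.
      ...   | inj₂ (inj₂ (r₁ , reds , vs)) = inj₂ (inj₂
              ( trans (ρ′-out z-out) r₁
              , (λ r d → [ (λ s → contradiction (proj₁ (same-inPair s)) z-out)
                         , (λ r′ → let h , k = reds r′ d in
                              h , Sum.map₂ (Sum.map (λ lt → subst (1 <_) (sym (ρ′-out (λ i →
                                <-irrefl (sym (proj₁ (open-in i))) lt))) lt) B⊑) k) ]′ (Recolour.split rec r))
              , λ r r′ → [ (λ s → v-out (proj₂ (same-inPair s)))
                         , (λ s → [ (λ s′ → v-out (proj₂ (same-inPair s′))) , vs s ]′ (Recolour.split rec r′)) ]′
                         (Recolour.split rec r)))
        where
          z-out : ¬ InPair σ x z
          z-out = [ z≢x , z≢σx ]′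

      answer : (∃ λ L → length L ≤ 1 × All (Free R x (σ x)) L ×
                 (∀ {B′} → Contains B′ L → ∀ {z} → InPair σ x z → Adj R z v → Adj B′ (σ z) v)) →
               Answer R B x (σ x)
      answer (L , short , free , vd) =
        (p , x) ∷ (p , σ x) ∷ L , s≤s (s≤s short) ,
        p-free (inj₁ refl) ∷ p-free (inj₂ refl) ∷ free ,
        λ { rec B⊑ (d₁ ∷ d₂ ∷ ds) → mkInv σ ρ′ v p
              (core′ rec B⊑ (λ { (inj₁ refl) → d₁ ; (inj₂ refl) → d₂ }) (vd ds)) (status′ rec B⊑) }

  -- The rank and the mate of a vertex meeting no red edge can be chosen afresh.
  module Reset {P : Fin n → Set} (P? : Decidable P) {r : ℕ} (r≢0 : r ≢ 0) {τ : Fin n → Fin n}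
               (isolated : ∀ {z t} → P z → ¬ Adj R z t) (p-out : ¬ P p)
               (σ-in : ∀ {z} → P z → P (σ z)) (τ-in : ∀ {z} → P z → P (τ z))
               (τ-out : ∀ {z} → ¬ P z → τ z ≡ σ z)
               (τ-involutive : ∀ z → τ (τ z) ≡ z) (τ-fixed : ∀ {z} → τ z ≡ z → z ≡ p) where

    ρ′ : Fin n → ℕ
    ρ′ = assign P? r ρ

    ρ′-in : ∀ {z} → P z → ρ′ z ≡ r
    ρ′-in = assign-in P? r ρ

    ρ′-out : ∀ {z} → ¬ P z → ρ′ z ≡ ρ z
    ρ′-out = assign-out P? r ρ

    red-out : ∀ {a b} → Adj R a b → ¬ P a
    red-out r h = isolated h r

    red-out′ : ∀ {a b} → Adj R a b → ¬ P b
    red-out′ r h = isolated h (Adj-sym r)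

    out-σ : ∀ {z} → ¬ P z → ¬ P (σ z)
    out-σ {z} ¬h h = ¬h (subst P (involutive z) (σ-in h))

    -- Every field that starts from a red edge concerns vertices outside `P`, where mates and ranks
    -- are unchanged; `r≢0` prevents new demands from `p-zero`.
    reset-core : Core R B τ ρ′ v p
    reset-core = record
      { involutive = τ-involutive ; fixed = τ-fixed
      ; rank-σ = rank-τ
      ; v-rank = trans (ρ′-out (red-out v-red)) v-rank
      ; v-red = subst (Adj R v) (sym (τ-out (red-out v-red))) v-red
      ; quad = quad′
      ; red-pair = λ {a} r → trans (ρ′-out (red-out r)) (red-pair (subst (Adj R a) (τ-out (red-out r)) r))
      ; p-zero = p-zero′
      ; p-paired = λ d → let h = p-paired (subst (_≢ p) τp d) in
                         subst (Adj B p) (sym τp) (proj₁ h) , trans (ρ′-out p-out) (proj₂ h)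
      ; p-lone = λ e {x} r → subst (λ t → Adj B t p × Adj B t v) (sym (τ-out (red-out r)))
                               (p-lone (trans (sym τp) e) r)
      ; p-lone-v = λ e {x} r d → subst (Adj B p) (sym (τ-out (red-out r)))
                               (p-lone-v (trans (sym τp) e) r (subst (x ≢_) (τ-out (red-out v-red)) d))
      }
      where
        τp : τ p ≡ σ p
        τp = τ-out p-out

        rank-τ : ∀ z → ρ′ (τ z) ≡ ρ′ z
        rank-τ z with P? z
        ... | yes h = ρ′-in (τ-in h)
        ... | no ¬h = trans (cong ρ′ (τ-out ¬h)) (trans (ρ′-out (out-σ ¬h)) (rank-σ z))

        quad′ : ∀ {a b} → Adj R a b → τ a ≢ a → τ b ≢ b → b ≢ τ a → ρ′ b ≤ ρ′ a →
                Adj B a (τ b) × Adj B (τ a) (τ b)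
        quad′ {a} {b} r da db d le
          rewrite τ-out (red-out r) | τ-out (red-out′ r) | ρ′-out (red-out r) | ρ′-out (red-out′ r) =
          quad r da db d le

        p-zero′ : ∀ {z} → τ z ≢ z → ρ′ z ≡ 0 → Adj B p z
        p-zero′ {z} d h with P? z
        ... | yes _ = contradiction h r≢0
        ... | no ¬h = p-zero (subst (_≢ z) (τ-out ¬h) d) h

    reset-status : ∀ {z} → ¬ P z → Status R B σ ρ v p z → Status R B τ ρ′ v p z
    reset-status {z} z-out st rewrite τ-out z-out = Sum.map₂ (Sum.map₂ reset-open) st
      where
        reset-open : Open R B σ ρ v p z →
          ρ′ z ≡ 1 × (∀ {y} → Adj R z y → y ≢ σ z → y ≢ p × (y ≡ v ⊎ 1 < ρ′ y ⊎ Adj B (σ z) y)) ×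
          (Adj R z v → ¬ Adj R (σ z) v)
        reset-open (r₁ , reds , vs) =
          trans (ρ′-out z-out) r₁ ,
          (λ r d → let h , k = reds r d in
             h , Sum.map₂ (Sum.map₁ (subst (1 <_) (sym (ρ′-out (red-out′ r))))) k) ,
          vs

    -- Without red edges the conditions of `Open` are vacuous, apart from the one on the rank.
    reset-in : r ≡ 1 → ∀ {z} → P z → Status R B τ ρ′ v p z
    reset-in r≡1 h = inj₂ (inj₂ (trans (ρ′-in h) r≡1 ,
      (λ r → contradiction r (isolated h)) , λ r → contradiction r (isolated h)))

    reset-statuses : r ≡ 1 → (∀ z → σ z ≢ z → Status R B σ ρ v p z) → ∀ z → τ z ≢ z → Status R B τ ρ′ v p z
    reset-statuses r≡1 status z d = by-cases (P? z)
      where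
        by-cases : Dec (P z) → Status R B τ ρ′ v p z
        by-cases (yes h) = reset-in r≡1 h
        by-cases (no ¬h) = reset-status ¬h (status z (subst (_≢ z) (τ-out ¬h) d))

-- Changing the pairing by conjugation with a transposition.

transpose-cases : ∀ (a b x : Fin n) →
  (x ≡ a × transpose a b x ≡ b) ⊎ (x ≡ b × transpose a b x ≡ a) ⊎ (x ≢ a × x ≢ b × transpose a b x ≡ x)
transpose-cases a b x with x ≟ a
... | yes e = inj₁ (e , refl)
... | no d with x ≟ b
...   | yes e = inj₂ (inj₁ (e , refl))
...   | no d′ = inj₂ (inj₂ (d , d′ , refl))

transpose-fix : ∀ {a b x : Fin n} → x ≢ a → x ≢ b → transpose a b x ≡ x
transpose-fix {a = a} {b} {x} d d′ with transpose-cases a b x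
... | inj₁ (e , _)                 = contradiction e d
... | inj₂ (inj₁ (e , _))          = contradiction e d′
... | inj₂ (inj₂ (_ , _ , e))      = e

transpose-left : ∀ (a b : Fin n) → transpose a b a ≡ b
transpose-left a b with transpose-cases a b a
... | inj₁ (_ , e)            = e
... | inj₂ (inj₁ (e , e′))    = trans e′ e
... | inj₂ (inj₂ (d , _ , _)) = contradiction refl d

transpose-right : ∀ (a b : Fin n) → transpose a b b ≡ a
transpose-right a b with transpose-cases a b b
... | inj₁ (e , e′)           = trans e′ e
... | inj₂ (inj₁ (_ , e))     = e
... | inj₂ (inj₂ (_ , d , _)) = contradiction refl d

transpose-involutive : ∀ (a b x : Fin n) → transpose a b (transpose a b x) ≡ x
transpose-involutive a b x with transpose-cases a b x
... | inj₁ (refl , e)            = trans (cong (transpose a b) e) (transpose-right a b)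
... | inj₂ (inj₁ (refl , e))     = trans (cong (transpose a b) e) (transpose-left a b)
... | inj₂ (inj₂ (_ , _ , e))    = trans (cong (transpose a b) e) e

transpose-elim : ∀ {Q : Fin n → Set} {a b x} → Q a → Q b → Q x → Q (transpose a b x)
transpose-elim {Q = Q} {a} {b} {x} qa qb qx with transpose-cases a b x
... | inj₁ (_ , e)            = subst Q (sym e) qb
... | inj₂ (inj₁ (_ , e))     = subst Q (sym e) qa
... | inj₂ (inj₂ (_ , _ , e)) = subst Q (sym e) qx

-- A conjugate of `σ` is again an involution and its fixed points are the transported ones;
-- exchanging `σ a` with `b` turns the mate of `a` into `b`.
module Rematch (σ : Fin n → Fin n) (σ-involutive : ∀ z → σ (σ z) ≡ z) (a b : Fin n) where

  rematch : Fin n → Fin n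
  rematch z = transpose (σ a) b (σ (transpose (σ a) b z))

  rematch-involutive : ∀ z → rematch (rematch z) ≡ z
  rematch-involutive z =
    trans (cong (transpose (σ a) b ∘ σ) (transpose-involutive (σ a) b (σ (transpose (σ a) b z))))
      (trans (cong (transpose (σ a) b) (σ-involutive (transpose (σ a) b z))) (transpose-involutive (σ a) b z))

  rematch-left : a ≢ σ a → a ≢ b → rematch a ≡ b
  rematch-left d d′ = trans (cong (transpose (σ a) b ∘ σ) (transpose-fix d d′)) (transpose-left (σ a) b)

  rematch-fixed : ∀ {z} → rematch z ≡ z → σ (transpose (σ a) b z) ≡ transpose (σ a) b z
  rematch-fixed {z} e = trans (sym (transpose-involutive (σ a) b _)) (cong (transpose (σ a) b) e)

-- Choosing the answer to Alice's edge.

Isolated : (R : List (Edge n)) (p z : Fin n) → Set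
Isolated R p z = z ≢ p × (∀ t → ¬ Adj R z t)

-- Since isolated vertices differ from `p`, neither `p` nor its mate is fresh, and the pair of `p`
-- is never rearranged.
Fresh : (R : List (Edge n)) (σ : Fin n → Fin n) (p z : Fin n) → Set
Fresh R σ p z = Isolated R p z × Isolated R p (σ z)

Isolated? : (R : List (Edge n)) (p : Fin n) → Decidable (Isolated R p)
Isolated? R p z = ¬? (z ≟ p) ×-dec all? (λ t → ¬? (Adj? R z t))

Fresh? : (R : List (Edge n)) (σ : Fin n → Fin n) (p : Fin n) → Decidable (Fresh R σ p)
Fresh? R σ p z = Isolated? R p z ×-dec Isolated? R p (σ z)

respond : ∀ {x y} → Proper R B → x ≢ y → ¬ Adj R x y → ¬ Adj B x y → Inv R B → Answer R B x y
respond {R = R} {B = B} {x} {y} proper x≢y ¬red ¬blue (mkInv σ ρ v p core status) =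
  cases (σ x ≟ x) (σ y ≟ y)
  where
    open Position proper core

    fresh-σ : ∀ {z} → Fresh R σ p z → Fresh R σ p (σ z)
    fresh-σ {z} (i , j) = j , subst (Isolated R p) (sym (involutive z)) i

    fresh-σ⁻ : ∀ {z} → Fresh R σ p (σ z) → Fresh R σ p z
    fresh-σ⁻ {z} f = subst (Fresh R σ p) (involutive z) (fresh-σ f)

    paired-fresh : ∀ {z} → Fresh R σ p z → Paired z
    paired-fresh f e = proj₁ (proj₁ f) (fixed e)

    -- Once `x` and `y` are made mates, Alice's edge lies inside a pair and `redden` applies; all
    -- fresh vertices are reset to rank 1 and hence open.
    both-fresh : Fresh R σ p x → Fresh R σ p y → Answer R B x y
    both-fresh fx fy = subst (Answer R B x) rx (redden proper reset-core
        (λ e → x≢y (sym (trans (sym rx) e)))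
        (λ r → ¬red (subst (Adj R x) rx r)) (λ b → ¬blue (subst (Adj B x) rx b)) (reset-statuses refl status))
      where
        open Rematch σ involutive x y

        rx : rematch x ≡ y
        rx = rematch-left (≢-sym (paired-fresh fx)) x≢y

        transpose-out : ∀ {z} → ¬ Fresh R σ p z → transpose (σ x) y z ≡ z
        transpose-out ¬f = transpose-fix (λ { refl → ¬f (fresh-σ fx) }) (λ { refl → ¬f fy })

        rematch-out : ∀ {z} → ¬ Fresh R σ p z → rematch z ≡ σ z
        rematch-out ¬f = trans (cong (transpose (σ x) y ∘ σ) (transpose-out ¬f)) (transpose-out (¬f ∘ fresh-σ⁻))

        p-out : ¬ Fresh R σ p p
        p-out f = proj₁ (proj₁ f) refl

        fixed′ : ∀ {z} → rematch z ≡ z → z ≡ p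
        fixed′ {z} e = trans (sym (transpose-involutive (σ x) y z))
          (trans (cong (transpose (σ x) y) (fixed (rematch-fixed e))) (transpose-out p-out))

        open Reset proper core (Fresh? R σ p) {1} (λ ())
          {rematch} (λ f → proj₂ (proj₁ f) _) p-out fresh-σ
          (λ f → transpose-elim {Q = Fresh R σ p} (fresh-σ fx) fy
                   (fresh-σ (transpose-elim {Q = Fresh R σ p} (fresh-σ fx) fy f)))
          rematch-out rematch-involutive fixed′

    -- A pair without red edges may be placed just above `y`, so that the strict case applies. For
    -- `y ≡ v` this rank is 1, so the pair is open and `attach` can be used.
    one-fresh : ∀ {x y} → Fresh R σ p x → Paired y → x ≢ y → y ≢ σ x → ¬ Adj B x y → Answer R B x y
    one-fresh {x} {y} fx y-paired x≢y y≢σx ¬blue = answer (y ≟ v)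
      where
        x-isolated : ∀ {z t} → InPair σ x z → ¬ Adj R z t
        x-isolated (inj₁ refl) = proj₂ (proj₁ fx) _
        x-isolated (inj₂ refl) = proj₂ (proj₂ fx) _

        p-out : ¬ InPair σ x p
        p-out (inj₁ q) = proj₁ (proj₁ fx) (sym q)
        p-out (inj₂ q) = proj₁ (proj₂ fx) (sym q)

        answer : Dec (y ≡ v) → Answer R B x y
        answer (yes refl) = Position.attach proper reset-core (paired-fresh fx) x≢y y≢σx ¬blue
            (subst (0 <_) (sym (ρ′-in (inj₁ refl))) (s≤s z≤n)) (reset-statuses refl status)
          where
            open Reset proper core (inPair? σ x) {1} (λ ()) {σ} x-isolated p-out
              (inPair-σ proper core) (inPair-σ proper core) (λ _ → refl) involutive fixed
        answer (no y≢v) = Position.outrank proper reset-core (paired-fresh fx) y-paired x≢y y≢σx ¬blue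
            (subst₂ _<_ (sym (ρ′-out [ ≢-sym x≢y , y≢σx ]′)) (sym (ρ′-in (inj₁ refl))) (n<1+n (ρ y))) y≢v
            (λ z d z≢x z≢σx → reset-status [ z≢x , z≢σx ]′ (status z d))
          where
            open Reset proper core (inPair? σ x) {suc (ρ y)} (λ ()) {σ} x-isolated p-out
              (inPair-σ proper core) (inPair-σ proper core) (λ _ → refl) involutive fixed

    descend : ∀ {x y} → Paired x → Paired y → x ≢ y → y ≢ σ x → ¬ Adj B x y → ρ y < ρ x → Answer R B x y
    descend {x} {y} dx dy x≢y y≢σx ¬blue lt with y ≟ v
    ... | yes refl = attach dx x≢y y≢σx ¬blue (subst (_< ρ x) v-rank lt) status
    ... | no y≢v   = outrank dx dy x≢y y≢σx ¬blue lt y≢v (λ z d _ _ → status z d)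

    flip-≢ : y ≢ σ x → x ≢ σ y
    flip-≢ d q = d (σ-flip (sym q))

    both-paired : Paired x → Paired y → y ≢ σ x → Answer R B x y
    both-paired dx dy y≢σx with Fresh? R σ p x | Fresh? R σ p y
    ... | yes fx | yes fy = both-fresh fx fy
    ... | yes fx | no _   = one-fresh fx dy x≢y y≢σx ¬blue
    ... | no _   | yes fy = Answer-sym (one-fresh fy dx (≢-sym x≢y) (flip-≢ y≢σx) (¬blue ∘ Adj-sym))
    ... | no _   | no _ with <-cmp (ρ x) (ρ y)
    ...   | tri< lt _ _ = Answer-sym (descend dy dx (≢-sym x≢y) (flip-≢ y≢σx) (¬blue ∘ Adj-sym) lt)
    ...   | tri≈ _ eq _ = level dx dy x≢y y≢σx ¬blue eq status
    ...   | tri> _ _ gt = descend dx dy x≢y y≢σx ¬blue gt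

    cases : Dec (σ x ≡ x) → Dec (σ y ≡ y) → Answer R B x y
    cases (yes ex) (yes ey) = contradiction (trans (fixed ex) (sym (fixed ey))) x≢y
    cases (yes ex) (no dy) with refl ← fixed ex = Answer-sym (lone ex dy (¬blue ∘ Adj-sym) status)
    cases (no dx) (yes ey) with refl ← fixed ey = lone ey dx ¬blue status
    cases (no dx) (no dy) with y ≟ σ x
    ... | yes refl = redden proper core dx ¬red ¬blue status
    ... | no y≢σx  = both-paired dx dy y≢σx

responsive : Responsive {n} Inv
responsive {x = x} {y} proper x≢y ¬red ¬blue inv with respond proper x≢y ¬red ¬blue inv
... | L , short , free , inv′ =
  L , short ,
  All.map (λ { (d , s , r) → d , [ s , r ]′ ∘ Adj-∷ }) free ,
  inv′ record { split = Adj-∷ ; keep = Adj-weaken ; add = inj₁ (here refl) }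

-- Comparing clique sizes.

∣∣≤-injection : ∀ {m n} (T : Subset m) (S : Subset n) (f : Fin m → Fin n) →
  (∀ {t} → t ∈ₛ T → f t ∈ₛ S) → (∀ {s t} → s ∈ₛ T → t ∈ₛ T → f s ≡ f t → s ≡ t) → ∣ T ∣ ≤ ∣ S ∣
∣∣≤-injection [] S f into inj = z≤n
∣∣≤-injection (outside ∷ T) S f into inj =
  ∣∣≤-injection T S (f ∘ suc) (into ∘ there) (λ s t e → suc-injective (inj (there s) (there t) e))
-- The image of the first element is deleted from `S`; injectivity keeps all later images in what is
-- left.
∣∣≤-injection (inside ∷ T) S f into inj =
  ≤-<-trans
    (∣∣≤-injection T (S - f zero) (f ∘ suc)
      (λ t → x∈p∧x≢y⇒x∈p-y (into (there t)) (λ e → case inj (there t) here e of λ ()))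
      (λ s t e → suc-injective (inj (there s) (there t) e)))
    (x∈p⇒∣p-x∣<∣p∣ (into here))

∣∣<-injection : ∀ {m n} (T : Subset m) (S : Subset n) (f : Fin m → Fin n) →
  (∀ {t} → t ∈ₛ T → f t ∈ₛ S) → (∀ {s t} → s ∈ₛ T → t ∈ₛ T → f s ≡ f t → s ≡ t) →
  ∀ {z} → z ∈ₛ S → (∀ {t} → t ∈ₛ T → f t ≢ z) → ∣ T ∣ < ∣ S ∣
∣∣<-injection T S f into inj {z} z∈S avoid =
  ≤-<-trans (∣∣≤-injection T (S - z) f (λ t → x∈p∧x≢y⇒x∈p-y (into t) (avoid t)) inj) (x∈p⇒∣p-x∣<∣p∣ z∈S)

module _ {P : Fin n → Set} (P? : Decidable P) where

  subset : Subset n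
  subset = tabulate (does ∘ P?)

  ∈-subset⁺ : ∀ {z} → P z → z ∈ₛ subset
  ∈-subset⁺ {z} h = lookup⇒[]= z subset (trans (lookup∘tabulate (does ∘ P?) z) (dec-true (P? z) h))

  ∈-subset⁻ : ∀ {z} → z ∈ₛ subset → P z
  ∈-subset⁻ {z} h = does-true (P? z) (trans (sym (lookup∘tabulate (does ∘ P?) z)) ([]=⇒lookup h))
    where
      does-true : ∀ {A : Set} (A? : Dec A) → does A? ≡ true → A
      does-true (yes a) _ = a

-- Irreflexivity of blue is used twice: distinct members of `T` have distinct images, and `z` is
-- none of these images. Hence the blue clique has one more vertex.
image-clique : (∀ {a} → ¬ Adj B a a) → (T : Subset n) (f : Fin n → Fin n) (z : Fin n) →
  (∀ {s t} → s ∈ₛ T → t ∈ₛ T → s ≢ t → Adj B (f s) (f t)) → (∀ {t} → t ∈ₛ T → Adj B z (f t)) →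
  ∃ λ S → IsClique B S × ∣ T ∣ < ∣ S ∣
image-clique {n = n} {B = B} irrefl T f z images extra =
  subset P? , clique , ∣∣<-injection T (subset P?) f
    (λ t → ∈-subset⁺ P? (inj₁ (_ , t , refl))) injective (∈-subset⁺ P? (inj₂ refl))
    (λ { t refl → irrefl (extra t) })
  where
    P : Fin n → Set
    P i = (∃ λ t → t ∈ₛ T × i ≡ f t) ⊎ i ≡ z

    P? : Decidable P
    P? i = any? (λ t → (t ∈ₛ? T) ×-dec (i ≟ f t)) ⊎-dec (i ≟ z)

    injective : ∀ {s t} → s ∈ₛ T → t ∈ₛ T → f s ≡ f t → s ≡ t
    injective {s} {t} s∈ t∈ e with s ≟ t
    ... | yes s≡t = s≡t
    ... | no s≢t  = contradiction (subst (Adj B (f s)) (sym e) (images s∈ t∈ s≢t)) irrefl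

    clique : IsClique B (subset P?)
    clique i j i∈ j∈ i≢j with ∈-subset⁻ P? i∈ | ∈-subset⁻ P? j∈
    ... | inj₁ (s , s∈ , refl) | inj₁ (t , t∈ , refl) = images s∈ t∈ (i≢j ∘ cong f)
    ... | inj₁ (s , s∈ , refl) | inj₂ refl            = Adj-sym (extra s∈)
    ... | inj₂ refl            | inj₁ (t , t∈ , refl) = extra t∈
    ... | inj₂ refl            | inj₂ refl            = contradiction refl i≢j

IsClique? : (E : List (Edge n)) → Decidable (IsClique E)
IsClique? E S = all? λ i → all? λ j →
  (i ∈ₛ? S) →-dec ((j ∈ₛ? S) →-dec (¬? (i ≟ j) →-dec Adj? E i j))

-- A clique is replaced by a larger one while there is any. The bound `n ≤ k + ∣ S ∣` is kept, so at
-- `k = 0` the clique has all `n` vertices.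
maximumClique : (E : List (Edge n)) → ∃ λ S → IsClique E S × (∀ T → IsClique E T → ∣ T ∣ ≤ ∣ S ∣)
maximumClique {n} E = improve n ∅ (λ _ _ i∈ → contradiction i∈ ∉⊥) (m≤m+n n _)
  where
    improve : ∀ k S → IsClique E S → n ≤ k + ∣ S ∣ →
              ∃ λ S′ → IsClique E S′ × (∀ T → IsClique E T → ∣ T ∣ ≤ ∣ S′ ∣)
    improve zero    S cl n≤ = S , cl , λ T _ → ≤-trans (∣p∣≤n T) n≤
    improve (suc k) S cl n≤ with anySubset? (λ T → IsClique? E T ×-dec (∣ S ∣ <? ∣ T ∣))
    ... | yes (T , clT , lt) = improve k T clT
            (≤-trans n≤ (≤-trans (≤-reflexive (sym (+-suc k ∣ S ∣))) (+-monoʳ-≤ k lt)))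
    ... | no none = S , cl , λ T clT → ≮⇒≥ (λ lt → none (T , clT , lt))

maximiser : ∀ {n} {Q : Fin n → Set} (Q? : Decidable Q) (ρ : Fin n → ℕ) →
  (∀ t → ¬ Q t) ⊎ ∃ λ x → Q x × (∀ {t} → Q t → ρ t ≤ ρ x)
maximiser {zero}  Q? ρ = inj₁ λ ()
maximiser {suc n} {Q} Q? ρ with Q? zero | maximiser (Q? ∘ suc) (ρ ∘ suc)
... | no ¬q | inj₁ none = inj₁ λ { zero → ¬q ; (suc t) → none t }
... | no ¬q | inj₂ (x , qx , top) = inj₂ (suc x , qx , λ { {zero} q → contradiction q ¬q ; {suc t} q → top q })
... | yes q | inj₁ none = inj₂ (zero , q , λ { {zero} _ → ≤-refl ; {suc t} qt → contradiction qt (none t) })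
... | yes q | inj₂ (x , qx , top) with ≤-total (ρ zero) (ρ (suc x))
...   | inj₁ le = inj₂ (suc x , qx , λ { {zero} _ → le ; {suc t} qt → top qt })
...   | inj₂ ge = inj₂ (zero , q , λ { {zero} _ → ≤-refl ; {suc t} qt → ≤-trans (top qt) ge })

-- Otherwise every vertex is one of three, and the vertices inject into `Fin 3`.
fourth : n ≥ 4 → (a b c : Fin n) → ∃ λ d → d ≢ a × d ≢ b × d ≢ c
fourth {n} n≥4 a b c with any? (λ d → ¬? (d ≟ a) ×-dec (¬? (d ≟ b) ×-dec ¬? (d ≟ c)))
... | yes found = found
... | no none   = contradiction (≤-trans n≥4 (injective⇒≤ code-injective)) λ { (s≤s (s≤s (s≤s ()))) }
  where
    at-c : ∀ {d} → d ≢ a → d ≢ b → d ≡ c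
    at-c {d} d≢a d≢b with d ≟ c
    ... | yes e = e
    ... | no d≢c = contradiction (d , d≢a , d≢b , d≢c) none

    code : Fin n → Fin 3
    code d with d ≟ a | d ≟ b
    ... | yes _ | _     = zero
    ... | no _  | yes _ = suc zero
    ... | no _  | no _  = suc (suc zero)

    code-injective : ∀ {d e} → code d ≡ code e → d ≡ e
    code-injective {d} {e} eq with d ≟ a | d ≟ b | e ≟ a | e ≟ b
    ... | yes p | _     | yes q | _     = trans p (sym q)
    ... | no _  | yes p | no _  | yes q = trans p (sym q)
    ... | no p  | no p′ | no q  | no q′ = trans (at-c p p′) (sym (at-c q q′))
    code-injective () | yes _ | _     | no _  | yes _
    code-injective () | yes _ | _     | no _  | no _
    code-injective () | no _  | yes _ | yes _ | _
    code-injective () | no _  | yes _ | no _  | no _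
    code-injective () | no _  | no _  | yes _ | _
    code-injective () | no _  | no _  | no _  | yes _

-- The final position: every red clique is beaten.

finishing : n ≥ 4 → Finishing {n} Inv
-- It suffices to beat one red clique of maximum size.
finishing {n} n≥4 {R} {B} proper cover (mkInv σ ρ v p core status) with maximumClique R
... | T , clT , maximal =
  let S , clS , lt = beaten in S , clS , λ T′ clT′ → ≤-<-trans (maximal T′ clT′) lt
  where
    open Position proper core
    open Proper proper

    -- A vertex `d` off `x`, `σ x` and `p` is paired. If `d` has rank 0, then `p` is blue to `d`,
    -- `x` and `σ x`, and `d` is blue to `x` or `σ x`. Otherwise `d` and `σ d` are joined in blue,
    -- and both are blue to `x`, or else `quad` makes both blue to `σ x`.
    triangle : ∀ {x} → Paired x → ρ x ≡ 0 → ∃ λ a → ∃ λ b → ∃ λ c → Adj B a b × Adj B c a × Adj B c b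
    triangle {x} x-paired zero-x with fourth n≥4 x (σ x) p
    ... | d , d≢x , d≢σx , d≢p = answer (ρ d ≟ℕ 0) (cover d≢x) (cover (≢-sym d≢σx ∘ sym ∘ σ-flip)) (cover (≢-sym d-paired))
      where
        d-paired : Paired d
        d-paired e = d≢p (fixed e)

        x≤ : ∀ z → ρ x ≤ z
        x≤ z = subst (_≤ z) (sym zero-x) z≤n

        x≢σd : x ≢ σ d
        x≢σd e = d≢σx (σ-flip (sym e))

        across : ∀ {z} → InPair σ d z → Adj R z x → Adj B z (σ x) × Adj B (σ z) (σ x)
        across (inj₁ refl) r = quad r d-paired x-paired x≢σd (x≤ _)
        across (inj₂ refl) r = quad r (paired-σ d-paired) x-paired (λ e → d≢x (sym (trans e (involutive d)))) (x≤ _)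

        zero-σx : ρ (σ x) ≡ 0
        zero-σx = trans (rank-σ x) zero-x

        answer : Dec (ρ d ≡ 0) → Adj R d x ⊎ Adj B d x → Adj R (σ d) x ⊎ Adj B (σ d) x →
                 Adj R d (σ d) ⊎ Adj B d (σ d) → ∃ λ a → ∃ λ b → ∃ λ c → Adj B a b × Adj B c a × Adj B c b
        answer (yes zero-d) (inj₁ r) _ _ = p , d , σ x , p-zero d-paired zero-d ,
          Adj-sym (p-zero (paired-σ x-paired) zero-σx) , Adj-sym (proj₁ (across (inj₁ refl) r))
        answer (yes zero-d) (inj₂ b) _ _ = p , d , x , p-zero d-paired zero-d ,
          Adj-sym (p-zero x-paired zero-x) , Adj-sym b
        answer (no ¬zero) _ _ (inj₁ r) = contradiction (red-pair r) ¬zero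
        answer (no _) (inj₁ r) _ (inj₂ b) =
          let b₁ , b₂ = across (inj₁ refl) r in d , σ d , σ x , b , Adj-sym b₁ , Adj-sym b₂
        answer (no _) (inj₂ _) (inj₁ r) (inj₂ b) =
          let b₁ , b₂ = across (inj₂ refl) r in
          d , σ d , σ x , b , Adj-sym (subst (λ t → Adj B t (σ x)) (involutive d) b₂) , Adj-sym b₁
        answer (no _) (inj₂ b₁) (inj₂ b₂) (inj₂ b) = d , σ d , x , b , Adj-sym b₁ , Adj-sym b₂

    zero-rank : ∀ {x} → x ∈ₛ T → Paired x → σ x ∈ₛ T → ρ x ≡ 0
    zero-rank {x} x∈ x-paired σx∈ = red-pair (clT x (σ x) x∈ σx∈ (≢-sym x-paired))

    -- A third vertex of `T` would be red to `x`, hence blue to `σ x` by `quad` or `p-lone`, a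
    -- contradiction. So `T` maps to two corners of a blue triangle and the third corner is the
    -- extra vertex.
    with-pair : ∀ {x} → x ∈ₛ T → Paired x → σ x ∈ₛ T → ∃ λ S → IsClique B S × ∣ T ∣ < ∣ S ∣
    with-pair {x} x∈ x-paired σx∈ with triangle x-paired (zero-rank x∈ x-paired σx∈)
    ... | a , b , c , ab , ca , cb = image-clique {B = B} blue-irrefl T f c images extra
      where
        only-pair : ∀ {t} → t ∈ₛ T → t ≢ x → t ≢ σ x → ⊥
        only-pair {t} t∈ t≢x t≢σx with σ t ≟ t
        ... | yes e with refl ← fixed e =
              disjoint (clT (σ x) p σx∈ t∈ (≢-sym t≢σx)) (proj₁ (p-lone e (clT x p x∈ t∈ (≢-sym t≢x))))
        ... | no t-paired =
              disjoint (clT t (σ x) t∈ σx∈ t≢σx)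
                (proj₁ (quad (clT t x t∈ x∈ t≢x) t-paired x-paired (λ e → t≢σx (σ-flip (sym e)))
                  (subst (_≤ ρ t) (sym (zero-rank x∈ x-paired σx∈)) z≤n)))

        f : Fin n → Fin n
        f t with t ≟ x
        ... | yes _ = a
        ... | no  _ = b

        images : ∀ {s t} → s ∈ₛ T → t ∈ₛ T → s ≢ t → Adj B (f s) (f t)
        images {s} {t} s∈ t∈ s≢t with s ≟ x | t ≟ x
        ... | yes p | yes q = contradiction (trans p (sym q)) s≢t
        ... | yes _ | no _  = ab
        ... | no _  | yes _ = Adj-sym ab
        ... | no p  | no q with s ≟ σ x | t ≟ σ x
        ...   | yes p′ | yes q′ = contradiction (trans p′ (sym q′)) s≢t
        ...   | no p′  | _      = ⊥-elim (only-pair s∈ p p′)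
        ...   | yes _  | no q′  = ⊥-elim (only-pair t∈ q q′)

        extra : ∀ {t} → t ∈ₛ T → Adj B c (f t)
        extra {t} _ with t ≟ x
        ... | yes _ = ca
        ... | no  _ = cb

    module Transversal (transversal : ∀ {x} → x ∈ₛ T → Paired x → ¬ σ x ∈ₛ T) where

      ≢σ : ∀ {s t} → s ∈ₛ T → Paired s → t ∈ₛ T → t ≢ σ s
      ≢σ s∈ d t∈ refl = transversal s∈ d t∈

      with-p : σ p ≡ p → p ∈ₛ T → ∃ λ S → IsClique B S × ∣ T ∣ < ∣ S ∣
      with-p e p∈ = image-clique {B = B} blue-irrefl T σ v images extra
        where
          images : ∀ {s t} → s ∈ₛ T → t ∈ₛ T → s ≢ t → Adj B (σ s) (σ t)
          images {s} {t} s∈ t∈ s≢t with σ s ≟ s | σ t ≟ t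
          ... | yes es | yes et = contradiction (trans (fixed es) (sym (fixed et))) s≢t
          ... | yes es | no _   with refl ← fixed es =
                subst (λ q → Adj B q (σ t)) (sym e) (Adj-sym (proj₁ (p-lone e (clT t p t∈ p∈ (≢-sym s≢t)))))
          ... | no _   | yes et with refl ← fixed et =
                subst (Adj B (σ s)) (sym e) (proj₁ (p-lone e (clT s p s∈ p∈ s≢t)))
          ... | no ds  | no dt  = mirror (clT s t s∈ t∈ s≢t) ds dt (≢σ s∈ ds t∈)

          extra : ∀ {t} → t ∈ₛ T → Adj B v (σ t)
          extra {t} t∈ with t ≟ p
          ... | yes refl = subst (Adj B v) (sym e) (Adj-sym pv-blue)
          ... | no t≢p   = Adj-sym (proj₂ (p-lone e (clT t p t∈ p∈ t≢p)))

      without-p : (∀ {t} → t ∈ₛ T → Paired t) → ∃ λ S → IsClique B S × ∣ T ∣ < ∣ S ∣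
      without-p paired with maximiser (_∈ₛ? T) ρ
      ... | inj₁ empty = image-clique {B = B} blue-irrefl T σ p 
        (λ s∈ → contradiction s∈ (empty _)) (λ t∈ → contradiction t∈ (empty _))
      ... | inj₂ (x , x∈ , top) = answer (cover (≢-sym (paired x∈)))
        where
          images : ∀ {s t} → s ∈ₛ T → t ∈ₛ T → s ≢ t → Adj B (σ s) (σ t)
          images {s} {t} s∈ t∈ s≢t = mirror (clT s t s∈ t∈ s≢t) (paired s∈) (paired t∈) (≢σ s∈ (paired s∈) t∈)

          answer : Adj R x (σ x) ⊎ Adj B x (σ x) → ∃ λ S → IsClique B S × ∣ T ∣ < ∣ S ∣
          answer (inj₁ r) = image-clique {B = B} blue-irrefl T σ p images λ {t} t∈ →
            p-zero (paired-σ (paired t∈))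
              (trans (rank-σ t) (n≤0⇒n≡0 (≤-trans (top t∈) (≤-reflexive (red-pair r)))))
          answer (inj₂ b) = image-clique {B = B} blue-irrefl T σ x images extra
            where
              extra : ∀ {t} → t ∈ₛ T → Adj B x (σ t)
              extra {t} t∈ with t ≟ x
              ... | yes refl = b
              ... | no t≢x   = proj₁ (quad (clT x t x∈ t∈ (≢-sym t≢x)) (paired x∈) (paired t∈)
                                           (≢σ x∈ (paired x∈) t∈) (top t∈))

    beaten : ∃ λ S → IsClique B S × ∣ T ∣ < ∣ S ∣
    beaten with any? (λ x → (x ∈ₛ? T) ×-dec (¬? (σ x ≟ x) ×-dec (σ x ∈ₛ? T)))
    ... | yes (x , x∈ , d , σx∈) = with-pair x∈ d σx∈
    ... | no none with (σ p ≟ p) ×-dec (p ∈ₛ? T)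
    ...   | yes (e , p∈) = Transversal.with-p (λ x∈ d σx∈ → none (_ , x∈ , d , σx∈)) e p∈
    ...   | no ¬p        = Transversal.without-p (λ x∈ d σx∈ → none (_ , x∈ , d , σx∈))
                             (λ {t} t∈ e → ¬p (subst (λ q → σ q ≡ q) (fixed e) e , subst (_∈ₛ T) (fixed e) t∈))

-- The initial pairing and the first round.

nearPerfectMatching : ∀ n → ∃ λ (τ : Fin n → Fin n) →
  (∀ z → τ (τ z) ≡ z) × (∀ {y z} → τ y ≡ y → τ z ≡ z → y ≡ z)
nearPerfectMatching zero = id , (λ ()) , λ { {()} }
nearPerfectMatching (suc zero) = id , (λ _ → refl) , λ { {zero} {zero} _ _ → refl }
nearPerfectMatching (suc (suc n)) with nearPerfectMatching n
... | τ , τ-involutive , τ-fixed = τ′ , involutive′ , fixed′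
  where
    τ′ : Fin (suc (suc n)) → Fin (suc (suc n))
    τ′ zero          = suc zero
    τ′ (suc zero)    = zero
    τ′ (suc (suc z)) = suc (suc (τ z))

    involutive′ : ∀ z → τ′ (τ′ z) ≡ z
    involutive′ zero          = refl
    involutive′ (suc zero)    = refl
    involutive′ (suc (suc z)) = cong (λ t → suc (suc t)) (τ-involutive z)

    fixed′ : ∀ {y z} → τ′ y ≡ y → τ′ z ≡ z → y ≡ z
    fixed′ {zero}  ()
    fixed′ {suc zero} ()
    fixed′ {suc (suc y)} {zero} _ ()
    fixed′ {suc (suc y)} {suc zero} _ ()
    fixed′ {suc (suc y)} {suc (suc z)} e e′ =
      cong (λ t → suc (suc t)) (τ-fixed (suc-injective (suc-injective e)) (suc-injective (suc-injective e′)))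

-- Rematching must start from a vertex that has a mate; if `v` is the unpaired vertex, then `w` is
-- not, and the roles are exchanged.
matchingThrough : (v w : Fin n) → v ≢ w → ∃ λ (σ : Fin n → Fin n) →
  (∀ z → σ (σ z) ≡ z) × (∀ {y z} → σ y ≡ y → σ z ≡ z → y ≡ z) × σ v ≡ w
matchingThrough {n} v w v≢w with nearPerfectMatching n
... | τ , τ-involutive , τ-fixed = choose (τ v ≟ v)
  where
    fixed′ : ∀ a b {y z} → let open Rematch τ τ-involutive a b in rematch y ≡ y → rematch z ≡ z → y ≡ z
    fixed′ a b {y} {z} e e′ =
      trans (sym (transpose-involutive (τ a) b y))
        (trans (cong (transpose (τ a) b) (τ-fixed (rematch-fixed e) (rematch-fixed e′)))
          (transpose-involutive (τ a) b z))
      where open Rematch τ τ-involutive a b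

    choose : Dec (τ v ≡ v) → ∃ λ (σ : Fin n → Fin n) →
      (∀ z → σ (σ z) ≡ z) × (∀ {y z} → σ y ≡ y → σ z ≡ z → y ≡ z) × σ v ≡ w
    choose (no d) = rematch , rematch-involutive , fixed′ v w , rematch-left (≢-sym d) v≢w
      where open Rematch τ τ-involutive v w
    choose (yes e) = rematch , rematch-involutive , fixed′ w v ,
      trans (cong rematch (sym (rematch-left (λ q → v≢w (τ-fixed e (sym q))) (≢-sym v≢w)))) (rematch-involutive w)
      where open Rematch τ τ-involutive w v

-- Alice's first edge becomes a pair of rank 0. The vertex `p` is the unpaired one if there is one,
-- and otherwise any vertex off `v` and `w`, with a third reply for its own edge.
opening : n ≥ 4 → {v w : Fin n} → v ≢ w →
  ∃ λ L → length L ≤ 3 × Demandable ((v , w) ∷ []) L × (∀ {B′} → Contains B′ L → Inv ((v , w) ∷ []) B′)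
opening {n} n≥4 {v} {w} v≢w with matchingThrough v w v≢w
... | σ , σ-involutive , σ-fixed , σv≡w = choose (any? (λ z → σ z ≟ z))
  where
    red⁻ : ∀ {a b} → Adj ((v , w) ∷ []) a b → Same v w a b
    red⁻ r = [ id , (λ { (inj₁ ()) ; (inj₂ ()) }) ]′ (Adj-∷ r)

    σw≡v : σ w ≡ v
    σw≡v = trans (cong σ (sym σv≡w)) (σ-involutive v)

    same-σ : ∀ {a b} → Same v w a b → b ≡ σ a
    same-σ (inj₁ (refl , q)) = trans q (sym σv≡w)
    same-σ (inj₂ (refl , q)) = trans q (sym σw≡v)

    module Start (p : Fin n) (p≢v : p ≢ v) (p≢w : p ≢ w) (fixed : ∀ {z} → σ z ≡ z → z ≡ p) where

      ρ₁ ρ : Fin n → ℕ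
      -- Rank 2 places the pair of `p` above the open pairs, whose rank is 1.
      ρ₁ = assign (inPair? σ p) 2 (λ _ → 1)
      ρ  = assign (inPair? σ v) 0 ρ₁

      σ-inPair : ∀ {x z} → InPair σ x z → InPair σ x (σ z)
      σ-inPair (inj₁ refl) = inj₂ refl
      σ-inPair (inj₂ refl) = inj₁ (σ-involutive _)

      σ-inPair⁻ : ∀ {x z} → InPair σ x (σ z) → InPair σ x z
      σ-inPair⁻ {x} {z} h = subst (InPair σ x) (σ-involutive z) (σ-inPair h)

      assign-σ : ∀ x k {f : Fin n → ℕ} → (∀ z → f (σ z) ≡ f z) →
                 ∀ z → assign (inPair? σ x) k f (σ z) ≡ assign (inPair? σ x) k f z
      assign-σ x k h z with inPair? σ x z
      ... | yes i = assign-in (inPair? σ x) k _ (σ-inPair i)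
      ... | no ¬i = trans (assign-out (inPair? σ x) k _ (¬i ∘ σ-inPair⁻)) (h z)

      ρ-v : ∀ {z} → InPair σ v z → ρ z ≡ 0
      ρ-v = assign-in (inPair? σ v) 0 ρ₁

      p-out : ¬ InPair σ v p
      p-out = [ p≢v , (λ q → p≢w (trans q σv≡w)) ]′

      ρ-zero : ∀ {z} → ρ z ≡ 0 → InPair σ v z
      ρ-zero {z} h with inPair? σ v z
      ... | yes i = i
      ... | no _ with inPair? σ p z
      ...   | yes _ = contradiction h λ ()
      ...   | no _  = contradiction h λ ()

      p-free : ∀ {z} → p ≢ z → p ≢ z × ¬ Adj ((v , w) ∷ []) p z
      p-free d = d , [ p≢v ∘ proj₁ , p≢w ∘ proj₁ ]′ ∘ red⁻

      inv : ∀ {B′} → Adj B′ p v → Adj B′ p w → (σ p ≢ p → Adj B′ p (σ p)) → Inv ((v , w) ∷ []) B′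
      inv {B′} pv pw pσp = mkInv σ ρ v p
        record
          { involutive = σ-involutive ; fixed = fixed
          ; rank-σ = assign-σ v 0 (assign-σ p 2 (λ _ → refl))
          ; v-rank = ρ-v (inj₁ refl)
          ; v-red = inj₁ (here (cong (v ,_) σv≡w))
          ; quad = λ r _ _ d → contradiction (same-σ (red⁻ r)) d
          ; red-pair = λ r → ρ-v ([ inj₁ ∘ proj₁ , (λ h → inj₂ (trans (proj₁ h) (sym σv≡w))) ]′ (red⁻ r))
          ; p-zero = λ { {z} _ h → [ (λ q → subst (Adj B′ p) (sym q) pv)
                                  , (λ q → subst (Adj B′ p) (sym (trans q σv≡w)) pw) ]′ (ρ-zero h) }
          ; p-paired = λ d → pσp d , trans (assign-out (inPair? σ v) 0 ρ₁ p-out) (assign-in (inPair? σ p) 2 _ (inj₁ refl))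
          ; p-lone = λ _ r → contradiction (red⁻ r) [ p≢w ∘ proj₂ , p≢v ∘ proj₂ ]′
          ; p-lone-v = λ _ r d → contradiction (red⁻ r) [ v≢w ∘ proj₂ , (λ h → d (trans (proj₁ h) (sym σv≡w))) ]′
          }
        status
        where
          status : ∀ z → σ z ≢ z → Status ((v , w) ∷ []) B′ σ ρ v p z
          status z d = by-cases (inPair? σ v z) (inPair? σ p z)
            where
              by-cases : Dec (InPair σ v z) → Dec (InPair σ p z) → Status ((v , w) ∷ []) B′ σ ρ v p z
              by-cases (yes (inj₁ refl)) _ = inj₂ (inj₁ (inj₁ (here (cong (v ,_) σv≡w))))
              by-cases (yes (inj₂ refl)) _ = inj₂ (inj₁ (inj₂ (here (cong₂ _,_ (σ-involutive v) σv≡w))))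
              by-cases (no _) (yes (inj₁ refl)) = inj₁ (pσp d)
              by-cases (no _) (yes (inj₂ refl)) =
                inj₁ (Adj-sym (subst (λ t → Adj B′ t (σ p)) (sym (σ-involutive p)) (pσp (d ∘ cong σ))))
              by-cases (no i) (no j) = inj₂ (inj₂
                ( trans (assign-out (inPair? σ v) 0 ρ₁ i) (assign-out (inPair? σ p) 2 _ j)
                , (λ r e → contradiction (same-σ (red⁻ r)) e)
                , λ r → contradiction (red⁻ r) [ i ∘ inj₁ ∘ proj₁ , (λ h → i (inj₂ (trans (proj₁ h) (sym σv≡w)))) ]′ ))

      answer : Dec (σ p ≡ p) → ∃ λ L → length L ≤ 3 × Demandable ((v , w) ∷ []) L ×
               (∀ {B′} → Contains B′ L → Inv ((v , w) ∷ []) B′)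
      answer (yes e) = (p , v) ∷ (p , w) ∷ [] , s≤s (s≤s z≤n) ,
        p-free p≢v ∷ p-free p≢w ∷ [] ,
        λ { (d₁ ∷ d₂ ∷ []) → inv d₁ d₂ (contradiction e) }
      answer (no d) = (p , v) ∷ (p , w) ∷ (p , σ p) ∷ [] , ≤-refl ,
        p-free p≢v ∷ p-free p≢w ∷ p-free (≢-sym d) ∷ [] ,
        λ { (d₁ ∷ d₂ ∷ d₃ ∷ []) → inv d₁ d₂ (λ _ → d₃) }

    choose : Dec (∃ λ z → σ z ≡ z) → ∃ λ L → length L ≤ 3 × Demandable ((v , w) ∷ []) L ×
             (∀ {B′} → Contains B′ L → Inv ((v , w) ∷ []) B′)
    choose (yes (p , e)) = Start.answer p
      (λ { refl → v≢w (trans (sym e) σv≡w) }) (λ { refl → v≢w (trans (sym σw≡v) e) })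
      (λ e′ → σ-fixed e′ e) (yes e)
    choose (no none) with fourth n≥4 v w v
    -- Only `v` and `w` are to be avoided, so `v` is listed twice.
    ... | p , p≢v , p≢w , _ = Start.answer p p≢v p≢w (λ e → contradiction (_ , e) none) (σ p ≟ p)

-- The invariant presupposes a red edge at `v`, so the first round is played separately. The board
-- is not empty at the start, because the first two vertices must be joined by some edge.
bobWins : n ≥ 4 → Valid {n} U [] [] → BobWins 1 3 U [] [] (alice 1)
bobWins {U = []} (s≤s (s≤s _)) V = contradiction (cover {zero} {suc zero} λ ())
    λ { (inj₁ (inj₁ ())) ; (inj₁ (inj₂ ()))
      ; (inj₂ (inj₁ (inj₁ ()))) ; (inj₂ (inj₁ (inj₂ ())))
      ; (inj₂ (inj₂ (inj₁ ()))) ; (inj₂ (inj₂ (inj₂ ()))) }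
  where open Valid V
bobWins {U = u ∷ U} n≥4 V = aliceMove λ m → aliceEnd (reply m)
  where
    reply : ∀ {e} (m : e ∈ (u ∷ U)) → BobWins 1 3 ((u ∷ U) ─ m) (e ∷ []) [] (bob 3)
    reply m with opening n≥4 (playable-≢ V m)
    ... | L , short , ds , inv = bobTurn (finishing n≥4) 3 L (Valid-red V m) ds short (λ _ → inv)
          (λ {U′} _ → play (finishing n≥4) responsive (length U′) ≤-refl)

theorem1p8 : (n : ℕ) → n ≥ 4 → Player2Wins 1 3 n
theorem1p8 n n≥4 = bobWins n≥4 (Valid-start n)
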